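{- Let $k \geq 1$ and consider the power of a cycle $C_n^k$. If $n \leq 2k+1$ or $n \geq 3k+2$, then the star-chromatic number of $C_n^k$ equals its biclique-chromatic number. If $2k+2 \leq n \leq 3k+1$, then $C_n^k$ has star-chromatic number $2$ if there exist natural numbers $a, b \geq 0$ such that $n = ak + b(k+1)$ and $a+b \geq 2$ is even, and star-chromatic number $3$ if no such natural numbers exist.
   Context: For $k \geq 1$, the power of a cycle $C_n^k$ is the simple graph with vertex set $\{v_0,\dots,v_{n-1}\}$ in which $v_i v_j$ ($i\neq j$) is an edge if and only if $\min\{(j-i) \bmod n, (i-j) \bmod n\} \leq k$. A biclique of a graph is a maximal (under inclusion) set of vertices inducing a complete bipartite subgraph with at least one edge. A star is a maximal (under inclusion) set of vertices inducing a complete bipartite subgraph that has a universal vertex (adjacent to all others in the set) and at least one edge. A biclique-colouring (resp. star-colouring) is an assignment of colours to vertices such that no biclique (resp. no star) is monochromatic; the biclique-chromatic number (resp. star-chromatic number) is the least $c$ such that such a colouring with at most $c$ colours exists. -}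

module Defs where

open import Data.Nat using (ℕ; zero; suc; _+_; _*_; _∸_; _≤_; _⊓_; _%_)
open import Data.Nat.Divisibility using (_∣_)
open import Data.Fin using (Fin; toℕ)
open import Data.Fin.Subset using (Subset; _∈_; _∉_; _⊆_; Nonempty)
open import Data.Product using (Σ; ∃; _×_)
open import Data.Sum using (_⊎_)
open import Relation.Nullary using (¬_)
open import Relation.Binary.PropositionalEquality using (_≡_; _≢_)

modDiff : ∀ {n} → Fin n → Fin n → ℕ
modDiff {suc m} i j = (toℕ j + suc m ∸ toℕ i) % suc m

Adj : (k : ℕ) {n : ℕ} → Fin n → Fin n → Set
Adj k i j = i ≢ j × (modDiff i j ⊓ modDiff j i ≤ k)

InducesCompleteBipartite : (k : ℕ) {n : ℕ} → Subset n → Set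
InducesCompleteBipartite k {n} S =
  Σ (Subset n) λ A → Σ (Subset n) λ B →
    (∀ x → x ∈ S → x ∈ A ⊎ x ∈ B) ×
    (∀ x → x ∈ A → x ∈ S) × (∀ x → x ∈ B → x ∈ S) ×
    (∀ x → x ∈ A → x ∉ B) ×
    Nonempty A × Nonempty B ×
    (∀ a b → a ∈ A → b ∈ B → Adj k a b) ×
    (∀ x y → x ∈ A → y ∈ A → ¬ Adj k x y) ×
    (∀ x y → x ∈ B → y ∈ B → ¬ Adj k x y)

InducesStar : (k : ℕ) {n : ℕ} → Subset n → Set
InducesStar k {n} S =
  InducesCompleteBipartite k S ×
  ∃ λ (u : Fin n) → u ∈ S × (∀ v → v ∈ S → v ≢ u → Adj k u v)

Maximal : ∀ {n} → (Subset n → Set) → Subset n → Set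
Maximal {n} P S = P S × (∀ (T : Subset n) → S ⊆ T → P T → T ⊆ S)

IsBiclique : (k : ℕ) {n : ℕ} → Subset n → Set
IsBiclique k = Maximal (InducesCompleteBipartite k)

IsStar : (k : ℕ) {n : ℕ} → Subset n → Set
IsStar k = Maximal (InducesStar k)

Monochromatic : ∀ {n c} → (Fin n → Fin c) → Subset n → Set
Monochromatic {n} {c} f S = ∃ λ (col : Fin c) → ∀ x → x ∈ S → f x ≡ col

BicliqueColouring : (k : ℕ) {n c : ℕ} → (Fin n → Fin c) → Set
BicliqueColouring k {n} f = ∀ (S : Subset n) → IsBiclique k S → ¬ Monochromatic f S

StarColouring : (k : ℕ) {n c : ℕ} → (Fin n → Fin c) → Set
StarColouring k {n} f = ∀ (S : Subset n) → IsStar k S → ¬ Monochromatic f S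

IsChromaticNumber : (n : ℕ) → (∀ {c} → (Fin n → Fin c) → Set) → ℕ → Set
IsChromaticNumber n P c =
  (∃ λ (f : Fin n → Fin c) → P f) ×
  (∀ (c' : ℕ) (f : Fin n → Fin c') → P f → c ≤ c')

BicliqueChromaticNumber : (k n c : ℕ) → Set
BicliqueChromaticNumber k n = IsChromaticNumber n (BicliqueColouring k)

StarChromaticNumber : (k n c : ℕ) → Set
StarChromaticNumber k n = IsChromaticNumber n (StarColouring k)

HasEvenRepresentation : (k n : ℕ) → Set
HasEvenRepresentation k n =
  ∃ λ (a : ℕ) → ∃ λ (b : ℕ) →
    n ≡ a * k + b * suc k × 2 ≤ a + b × 2 ∣ (a + b)

{-# OPTIONS --safe #-}
-- Two non-adjacent neighbours of a vertex of C_n^k lie on different sides of it, so for n ≥ 2k+2 the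
-- graph is claw-free, its stars are exactly the induced paths x u y, and every biclique contains one.
-- Thus star-colourings are the colourings without monochromatic induced path, and they are
-- biclique-colourings. Cutting the cycle into an even number of arcs of lengths k and k+1 coloured
-- alternately gives such a 2-colouring, and one shorter arc is always affordable with a third colour.
-- Conversely, the induced paths of span k+1 and k+2 force the monochromatic arcs of a 2-colouring to
-- have lengths k and k+1. For n ≥ 3k+2 these paths are bicliques, except that those of span k+2 have
-- to be completed to a square when n = 3k+2, so already a biclique 2-colouring has such arcs.
module Submission where

open import Defs
open import Data.Bool using (Bool; true; false; T; _∧_; _∨_; not)
import Data.Bool.Properties as Bool
open import Data.Empty using (⊥; ⊥-elim)
open import Data.Fin using (Fin; zero; suc; toℕ)
import Data.Fin.Properties as Fin
open import Data.Fin.Subset using (Subset; _∈_; _⊆_; ⁅_⁆; _∪_)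
open import Data.Fin.Subset.Properties using (_∈?_; x∈⁅x⁆; x∈⁅y⁆⇒x≡y; x∈p∪q⁺; x∈p∪q⁻)
import Data.Integer as ℤ
import Data.Integer.Properties as ℤ
import Data.Integer.Tactic.RingSolver as ℤ-Solver
open import Data.List using (List; []; _∷_; _++_; map; cartesianProductWith; filterᵇ)
open import Data.List.Relation.Unary.All as All using (All; []; _∷_)
open import Data.List.Relation.Unary.All.Properties using (map⁺; ++⁺)
open import Data.Maybe using (Maybe; just; nothing)
open import Data.Nat using (ℕ; zero; suc; _+_; _*_; _∸_; _≤_; _<_; _⊓_; _/_; _%_; s≤s; z≤n; NonZero; >-nonZero)
open import Data.Nat.Divisibility using (_∣_; divides; ∣⇒≤; _∣0)
open import Data.Nat.DivMod using (_mod_; m≡m%n+[m/n]*n; [m+kn]%n≡m%n; [m+n]%n≡m%n; m<n⇒m%n≡m; m%n<n; n%n≡0)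
import Data.Nat.Properties as ℕ
open import Data.Product using (∃; _×_; _,_; proj₁; proj₂; map₂)
import Data.Sum as Sum
open import Data.Sum using (_⊎_; inj₁; inj₂; [_,_]′)
open import Data.Vec using (Vec; []; _∷_; lookup; replicate; zipWith; tabulate)
open import Data.Vec.N-ary using (N-ary; _$ⁿ_)
open import Function using (_∘_; Equivalence)
open import Function.Bundles using (_⇔_; mk⇔)
open import Relation.Binary.Definitions using (tri<; tri≈; tri>)
open import Relation.Binary.PropositionalEquality
open import Relation.Nullary using (¬_; Dec; yes; no; ¬?)
open import Relation.Nullary.Decidable using (⌊_⌋; decidable-stable; _×-dec_; _⊎-dec_; _→-dec_)

-- Linear arithmetic over ℕ

-- The bound 3k+2 comes from the far arc of an induced path of span s: it has length n - s and
-- contains a common neighbour of the two ends exactly when n - s ≤ 2k. For span k+1 this fails as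
-- soon as n ≥ 3k+2. For span k+2 it still happens at n = 3k+2, and there the only such vertex is
-- the midpoint of the far arc, the fourth corner of the square. In the converse, paths of span k+1
-- bound the arcs from above, and one path of span k+2 is needed to exclude arcs that are too short.
-- The paths of span k+1 used on the way also fix the colour of that fourth corner, so the
-- exceptional case fits into the same argument. Cyclic distance involves remainders and truncated
-- subtraction. Working with positions in ℕ, on which colourings are periodic, turns arcs into
-- intervals and leaves many small linear inequalities, which are discharged by a reflective
-- decision procedure.

module LinearArithmetic where

  open import Data.Integer using (ℤ; +_; -[1+_]; 0ℤ)

  Row : ℕ → Set
  Row n = ℤ × Vec ℤ n

  dot : ∀ {n} → Vec ℤ n → Vec ℕ n → ℤ
  dot []       []      = 0ℤ
  dot (c ∷ cs) (x ∷ ρ) = c ℤ.* + x ℤ.+ dot cs ρ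

  value : ∀ {n} → Row n → Vec ℕ n → ℤ
  value (c , cs) ρ = c ℤ.+ dot cs ρ

  Holds : ∀ {n} → Vec ℕ n → Row n → Set
  Holds ρ r = 0ℤ ℤ.≤ value r ρ

  combine : ∀ {n} → ℤ → ℤ → Row n → Row n → Row n
  combine a b (c , cs) (d , ds) = a ℤ.* c ℤ.+ b ℤ.* d , zipWith (λ x y → a ℤ.* x ℤ.+ b ℤ.* y) cs ds

  value-combine : ∀ {n} a b (p q : Row n) ρ →
    value (combine a b p q) ρ ≡ a ℤ.* value p ρ ℤ.+ b ℤ.* value q ρ
  value-combine a b (c , []) (d , []) [] = step a b c d
    where
    step : ∀ a b c d → a ℤ.* c ℤ.+ b ℤ.* d ℤ.+ 0ℤ ≡ a ℤ.* (c ℤ.+ 0ℤ) ℤ.+ b ℤ.* (d ℤ.+ 0ℤ)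
    step = ℤ-Solver.solve-∀
  value-combine a b (c , x ∷ cs) (d , y ∷ ds) (v ∷ ρ) =
    trans (shift (a ℤ.* c ℤ.+ b ℤ.* d) ((a ℤ.* x ℤ.+ b ℤ.* y) ℤ.* + v) _)
      (trans (cong (λ z → (a ℤ.* x ℤ.+ b ℤ.* y) ℤ.* + v ℤ.+ z) (value-combine a b (c , cs) (d , ds) ρ))
        (step a b c d x y (+ v) (dot cs ρ) (dot ds ρ)))
    where
    shift : ∀ p q r → p ℤ.+ (q ℤ.+ r) ≡ q ℤ.+ (p ℤ.+ r)
    shift = ℤ-Solver.solve-∀
    step : ∀ a b c d x y v s t →
      (a ℤ.* x ℤ.+ b ℤ.* y) ℤ.* v ℤ.+ (a ℤ.* (c ℤ.+ s) ℤ.+ b ℤ.* (d ℤ.+ t)) ≡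
      a ℤ.* (c ℤ.+ (x ℤ.* v ℤ.+ s)) ℤ.+ b ℤ.* (d ℤ.+ (y ℤ.* v ℤ.+ t))
    step = ℤ-Solver.solve-∀

  scale-nonNeg : ∀ a {x} → 0ℤ ℤ.≤ x → 0ℤ ℤ.≤ + a ℤ.* x
  scale-nonNeg a {x} h = subst (λ z → z ℤ.≤ + a ℤ.* x) (ℤ.*-zeroʳ (+ a)) (ℤ.*-monoˡ-≤-nonNeg (+ a) h)

  Holds-combine : ∀ {n} (ρ : Vec ℕ n) a b {p q} →
    Holds ρ p → Holds ρ q → Holds ρ (combine (+ a) (+ b) p q)
  Holds-combine ρ a b {p} {q} hp hq = subst (0ℤ ℤ.≤_) (sym (value-combine (+ a) (+ b) p q ρ))
    (ℤ.+-mono-≤ (scale-nonNeg a hp) (scale-nonNeg b hq))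

  head : ∀ {n} → Row (suc n) → ℤ
  head (_ , x ∷ _) = x

  positive negative : ∀ {n} → Row (suc n) → Bool
  positive r = ⌊ 0ℤ ℤ.<? head r ⌋
  negative r = ⌊ head r ℤ.<? 0ℤ ⌋

  -- Replaces the head coefficient by 0. This preserves equations whose head is 0, and inequalities
  -- whose head is not positive; every other row is replaced by the trivial one.
  drop-eq drop-ineq : ∀ {n} → Row (suc n) → Row n
  drop-eq (c , + zero ∷ cs) = c , cs
  drop-eq _                 = 0ℤ , replicate _ 0ℤ
  drop-ineq (c , + suc _ ∷ _) = 0ℤ , replicate _ 0ℤ
  drop-ineq (c , _ ∷ cs)      = c , cs

  -- The heads cancel when `p` has a positive and `q` a negative one. Soundness needs no signs,
  -- since both multipliers are absolute values.
  resolve : ∀ {n} → Row (suc n) → Row (suc n) → Row (suc n)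
  resolve p q = combine (+ ℤ.∣ head q ∣) (+ ℤ.∣ head p ∣) p q

  -- `e` is an equation, so its multiplier may have any sign and is chosen to cancel the head of
  -- `r`. The multiplier of `r` is an absolute value, so `r` may be an inequality as well.
  reduce : ∀ {n} → Row (suc n) → Row (suc n) → Row (suc n)
  reduce e r = combine (+ ℤ.∣ head e ∣) (ℤ.- (ℤ.sign (head e) ℤ.◃ 1) ℤ.* head r) r e

  -- Since the variables are natural numbers, rows without negative coefficients carry no information.
  informative : ∀ {n} → Row n → Bool
  informative (c , cs) = ⌊ c ℤ.<? 0ℤ ⌋ ∨ any cs
    where
    any : ∀ {n} → Vec ℤ n → Bool
    any []       = false
    any (c ∷ cs) = ⌊ c ℤ.<? 0ℤ ⌋ ∨ any cs

  record System (n : ℕ) : Set where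
    constructor _&_
    field
      equations inequalities : List (Row n)

  pivot : ∀ {n} → List (Row (suc n)) → Maybe (Row (suc n))
  pivot []       = nothing
  pivot (r ∷ rs) with head r
  ... | + zero = pivot rs
  ... | _      = just r

  -- Gaussian elimination of the head variable if it occurs in an equation, and otherwise
  -- Fourier–Motzkin elimination; drop-ineq accounts for the inequality 0 ≤ x.
  eliminate : ∀ {n} → System (suc n) → System n
  eliminate (es & is) with pivot es
  ... | just e  = map (drop-eq ∘ reduce e) es & filterᵇ informative (map (drop-ineq ∘ reduce e) is)
  ... | nothing = map drop-eq es & filterᵇ informative (map drop-ineq
    (is ++ cartesianProductWith resolve (filterᵇ positive is) (filterᵇ negative is)))

  contradictory : System 0 → Bool
  contradictory ([] & [])                    = false
  contradictory ([] & ((-[1+ _ ] , _) ∷ _))  = true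
  contradictory ([] & (_ ∷ is))              = contradictory ([] & is)
  contradictory (((+ zero , _) ∷ es) & is)   = contradictory (es & is)
  -- What remains is an equation between 0 and a nonzero constant.
  contradictory (_ & is)                     = true

  refutes : ∀ {n} → System n → Bool
  refutes {zero}  s = contradictory s
  refutes {suc n} s = refutes (eliminate s)

  dot-zero : ∀ {n} (ρ : Vec ℕ n) → dot (replicate n 0ℤ) ρ ≡ 0ℤ
  dot-zero []      = refl
  dot-zero (x ∷ ρ) = trans (cong (λ z → z ℤ.+ dot (replicate _ 0ℤ) ρ) (ℤ.*-zeroˡ (+ x)))
    (trans (ℤ.+-identityˡ _) (dot-zero ρ))

  Vanishes : ∀ {n} → Vec ℕ n → Row n → Set
  Vanishes ρ r = value r ρ ≡ 0ℤ

  record Satisfies {n} (ρ : Vec ℕ n) (s : System n) : Set where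
    constructor _&_
    open System s
    field
      vanish : All (Vanishes ρ) equations
      hold   : All (Holds ρ) inequalities

  module _ {n} {v : ℕ} {ρ : Vec ℕ n} where

    zero-head : ∀ c cs → value (c , 0ℤ ∷ cs) (v ∷ ρ) ≡ value (c , cs) ρ
    zero-head c cs = cong (λ z → c ℤ.+ z)
      (trans (cong (λ z → z ℤ.+ dot cs ρ) (ℤ.*-zeroˡ (+ v))) (ℤ.+-identityˡ _))

    drop-eq-sound : ∀ {r} → Vanishes (v ∷ ρ) r → Vanishes ρ (drop-eq r)
    drop-eq-sound {c , + zero ∷ cs}   h = trans (sym (zero-head c cs)) h
    drop-eq-sound {c , + suc _ ∷ cs}  h = trans (ℤ.+-identityˡ _) (dot-zero ρ)
    drop-eq-sound {c , -[1+ _ ] ∷ cs} h = trans (ℤ.+-identityˡ _) (dot-zero ρ)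

    drop-ineq-sound : ∀ {r} → Holds (v ∷ ρ) r → Holds ρ (drop-ineq r)
    drop-ineq-sound {c , + suc _ ∷ cs}  h = ℤ.≤-reflexive (sym (cong (λ z → 0ℤ ℤ.+ z) (dot-zero ρ)))
    drop-ineq-sound {c , + zero ∷ cs}   h = subst (0ℤ ℤ.≤_) (zero-head c cs) h
    drop-ineq-sound {c , -[1+ a ] ∷ cs} h = ℤ.≤-trans h (ℤ.+-monoʳ-≤ c
      (subst (λ z → -[1+ a ] ℤ.* + v ℤ.+ dot cs ρ ℤ.≤ z) (ℤ.+-identityˡ (dot cs ρ))
        (ℤ.+-monoˡ-≤ (dot cs ρ) (ℤ.*-monoʳ-≤-nonNeg (+ v) { -[1+ a ]} {0ℤ} ℤ.-≤+))))

    resolve-sound : ∀ {p q} → Holds (v ∷ ρ) p → Holds (v ∷ ρ) q → Holds (v ∷ ρ) (resolve p q)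
    resolve-sound {p} {q} = Holds-combine (v ∷ ρ) ℤ.∣ head q ∣ ℤ.∣ head p ∣ {p} {q}

  value-reduce : ∀ {n} {ρ : Vec ℕ (suc n)} {e r} → Vanishes ρ e →
    value (reduce e r) ρ ≡ + ℤ.∣ head e ∣ ℤ.* value r ρ
  value-reduce {ρ = ρ} {e} {r} he = trans (value-combine (+ ℤ.∣ head e ∣) t r e ρ)
    (trans (cong (λ z → + ℤ.∣ head e ∣ ℤ.* value r ρ ℤ.+ z) (trans (cong (λ z → t ℤ.* z) he) (ℤ.*-zeroʳ t)))
      (ℤ.+-identityʳ _))
    where
    t = ℤ.- (ℤ.sign (head e) ℤ.◃ 1) ℤ.* head r

  module _ {A : Set} {P : A → Set} where

    filterᵇ-All : ∀ p {xs} → All P xs → All P (filterᵇ p xs)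
    filterᵇ-All p [] = []
    filterᵇ-All p {x ∷ xs} (h ∷ hs) with p x
    ... | true  = h ∷ filterᵇ-All p hs
    ... | false = filterᵇ-All p hs

    map-All : ∀ {B : Set} {Q : B → Set} {f : A → B} → (∀ {x} → P x → Q (f x)) →
      ∀ {xs} → All P xs → All Q (map f xs)
    map-All g hs = map⁺ (All.map g hs)

  product-All : ∀ {A : Set} {P : A → Set} {f : A → A → A} → (∀ {x y} → P x → P y → P (f x y)) →
    ∀ {xs ys} → All P xs → All P ys → All P (cartesianProductWith f xs ys)
  product-All g []       ks = []
  product-All {P = P} g (h ∷ hs) ks = ++⁺ (map-All {P = P} (g h) ks) (product-All g hs ks)

  pivot-sound : ∀ {n} {P : Row (suc n) → Set} {es e} → All P es → pivot es ≡ just e → P e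
  pivot-sound {es = r ∷ rs} (h ∷ hs) eq with head r
  pivot-sound {es = r ∷ rs} (h ∷ hs) eq   | + zero    = pivot-sound hs eq
  pivot-sound {es = r ∷ rs} (h ∷ hs) refl | + suc _   = h
  pivot-sound {es = r ∷ rs} (h ∷ hs) refl | -[1+ _ ]  = h

  eliminate-sound : ∀ {n v} {ρ : Vec ℕ n} s → Satisfies (v ∷ ρ) s → Satisfies ρ (eliminate s)
  eliminate-sound {v = v} {ρ} (es & is) (vs & hs) with pivot es in eq
  ... | just e =
    map-All {P = Vanishes (v ∷ ρ)} (λ {r} h → drop-eq-sound {r = reduce e r}
      (trans (value-reduce {e = e} {r} he) (trans (cong (λ z → a ℤ.* z) h) (ℤ.*-zeroʳ a)))) vs &
    filterᵇ-All informative (map-All {P = Holds (v ∷ ρ)} (λ {r} h → drop-ineq-sound {r = reduce e r}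
      (subst (0ℤ ℤ.≤_) (sym (value-reduce {e = e} {r} he)) (scale-nonNeg ℤ.∣ head e ∣ h))) hs)
    where
    a = + ℤ.∣ head e ∣
    he = pivot-sound {P = Vanishes (v ∷ ρ)} vs eq
  ... | nothing =
    map-All {P = Vanishes (v ∷ ρ)} (λ {r} → drop-eq-sound {r = r}) vs &
    filterᵇ-All informative (map-All {P = Holds (v ∷ ρ)} (λ {r} → drop-ineq-sound {r = r})
      (++⁺ hs (product-All (λ {p} {q} → resolve-sound {p = p} {q})
        (filterᵇ-All positive hs) (filterᵇ-All negative hs))))

  contradictory-sound : ∀ s → T (contradictory s) → Satisfies [] s → ⊥
  contradictory-sound ([] & ((-[1+ _ ] , []) ∷ _)) t ([] & (() ∷ _))
  contradictory-sound ([] & ((+ _ , _) ∷ is)) t ([] & (_ ∷ hs)) = contradictory-sound ([] & is) t ([] & hs)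
  contradictory-sound (((+ zero , _) ∷ es) & is) t ((_ ∷ vs) & hs) = contradictory-sound (es & is) t (vs & hs)
  contradictory-sound (((+ suc _ , []) ∷ es) & is) t ((() ∷ vs) & hs)
  contradictory-sound (((-[1+ _ ] , []) ∷ es) & is) t ((() ∷ vs) & hs)

  refutes-sound : ∀ {n} (ρ : Vec ℕ n) s → T (refutes s) → Satisfies ρ s → ⊥
  refutes-sound []      s t hs = contradictory-sound s t hs
  refutes-sound (v ∷ ρ) s t hs = refutes-sound ρ (eliminate s) t (eliminate-sound s hs)

  -- Reflected formulas and the decision procedure

  infixl 6 _:+_
  infixl 7 _:*_
  infix  4 _:≤_ _:<_ _:≡_
  infixr 3 _:×_
  infixr 2 _:⊎_
  infixr 1 _:⇒_

  data Expr (n : ℕ) : Set where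
    var  : Fin n → Expr n
    #_   : ℕ → Expr n
    _:+_ : Expr n → Expr n → Expr n
    _:*_ : ℕ → Expr n → Expr n

  data Formula (n : ℕ) : Set where
    _:≤_ _:<_ _:≡_ : Expr n → Expr n → Formula n
    _:×_ _:⊎_ _:⇒_ : Formula n → Formula n → Formula n
    :⊥             : Formula n

  ⟦_⟧ : ∀ {n} → Expr n → Vec ℕ n → ℕ
  ⟦ var i  ⟧ ρ = lookup ρ i
  ⟦ # c    ⟧ ρ = c
  ⟦ a :+ b ⟧ ρ = ⟦ a ⟧ ρ + ⟦ b ⟧ ρ
  ⟦ c :* a ⟧ ρ = c * ⟦ a ⟧ ρ

  ⟪_⟫ : ∀ {n} → Formula n → Vec ℕ n → Set
  ⟪ a :≤ b ⟫ ρ = ⟦ a ⟧ ρ ≤ ⟦ b ⟧ ρ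
  ⟪ a :< b ⟫ ρ = ⟦ a ⟧ ρ < ⟦ b ⟧ ρ
  ⟪ a :≡ b ⟫ ρ = ⟦ a ⟧ ρ ≡ ⟦ b ⟧ ρ
  ⟪ p :× q ⟫ ρ = ⟪ p ⟫ ρ × ⟪ q ⟫ ρ
  ⟪ p :⊎ q ⟫ ρ = ⟪ p ⟫ ρ ⊎ ⟪ q ⟫ ρ
  ⟪ p :⇒ q ⟫ ρ = ⟪ p ⟫ ρ → ⟪ q ⟫ ρ
  ⟪ :⊥     ⟫ ρ = ⊥

  ⟪_⟫? : ∀ {n} (p : Formula n) ρ → Dec (⟪ p ⟫ ρ)
  ⟪ a :≤ b ⟫? ρ = _ ℕ.≤? _
  ⟪ a :< b ⟫? ρ = _ ℕ.<? _
  ⟪ a :≡ b ⟫? ρ = _ ℕ.≟ _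
  ⟪ p :× q ⟫? ρ = ⟪ p ⟫? ρ ×-dec ⟪ q ⟫? ρ
  ⟪ p :⊎ q ⟫? ρ = ⟪ p ⟫? ρ ⊎-dec ⟪ q ⟫? ρ
  ⟪ p :⇒ q ⟫? ρ = ⟪ p ⟫? ρ →-dec ⟪ q ⟫? ρ
  ⟪ :⊥     ⟫? ρ = no λ ()

  unit : ∀ {n} → Fin n → Vec ℤ n
  unit zero    = + 1 ∷ replicate _ 0ℤ
  unit (suc i) = 0ℤ ∷ unit i

  row : ∀ {n} → Expr n → Row n
  row (var i)  = 0ℤ , unit i
  row (# c)    = + c , replicate _ 0ℤ
  row (a :+ b) = combine (+ 1) (+ 1) (row a) (row b)
  row (c :* a) = combine (+ c) 0ℤ (row a) (row a)

  dot-unit : ∀ {n} (i : Fin n) ρ → dot (unit i) ρ ≡ + lookup ρ i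
  dot-unit zero    (x ∷ ρ) = trans (cong₂ ℤ._+_ (ℤ.*-identityˡ (+ x)) (dot-zero ρ)) (ℤ.+-identityʳ (+ x))
  dot-unit (suc i) (x ∷ ρ) = trans (cong₂ ℤ._+_ (ℤ.*-zeroˡ (+ x)) (dot-unit i ρ)) (ℤ.+-identityˡ _)

  row-sound : ∀ {n} (a : Expr n) ρ → value (row a) ρ ≡ + ⟦ a ⟧ ρ
  row-sound (var i)  ρ = trans (ℤ.+-identityˡ _) (dot-unit i ρ)
  row-sound (# c)    ρ = trans (cong (λ z → + c ℤ.+ z) (dot-zero ρ)) (ℤ.+-identityʳ (+ c))
  row-sound (a :+ b) ρ = trans (value-combine (+ 1) (+ 1) (row a) (row b) ρ)
    (cong₂ ℤ._+_ (trans (ℤ.*-identityˡ _) (row-sound a ρ)) (trans (ℤ.*-identityˡ _) (row-sound b ρ)))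
  row-sound (c :* a) ρ = trans (value-combine (+ c) 0ℤ (row a) (row a) ρ)
    (trans (cong₂ ℤ._+_ (cong (λ z → + c ℤ.* z) (row-sound a ρ)) (ℤ.*-zeroˡ (value (row a) ρ)))
      (trans (ℤ.+-identityʳ _) (sym (ℤ.pos-* c (⟦ a ⟧ ρ)))))

  _⊖_ : ∀ {n} → Expr n → Expr n → Row n
  b ⊖ a = combine (+ 1) (-[1+ 0 ]) (row b) (row a)

  ⊖-value : ∀ {n} (a b : Expr n) ρ → value (b ⊖ a) ρ ≡ + ⟦ b ⟧ ρ ℤ.- + ⟦ a ⟧ ρ
  ⊖-value a b ρ = trans (value-combine (+ 1) -[1+ 0 ] (row b) (row a) ρ)
    (trans (cong₂ (λ x y → + 1 ℤ.* x ℤ.+ -[1+ 0 ] ℤ.* y) (row-sound b ρ) (row-sound a ρ))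
      (minus (+ ⟦ b ⟧ ρ) (+ ⟦ a ⟧ ρ)))
    where
    minus : ∀ x y → + 1 ℤ.* x ℤ.+ -[1+ 0 ] ℤ.* y ≡ x ℤ.- y
    minus = ℤ-Solver.solve-∀

  -- Asserts p (or its negation, if the polarity is false) on top of the system s and
  -- continues with c on every branch of the disjunctive normal form.
  assert : ∀ {n} → Bool → Formula n → (System n → Bool) → System n → Bool
  assert true  (a :≤ b) c (es & is) = c (es & (b ⊖ a ∷ is))
  -- Integrality enters only by writing strict inequalities with `+ 1`, here and in the clauses
  -- below; the elimination itself is valid over the rationals.
  assert false (a :≤ b) c (es & is) = c (es & (a ⊖ (b :+ # 1) ∷ is))
  assert true  (a :< b) c (es & is) = c (es & (b ⊖ (a :+ # 1) ∷ is))
  assert false (a :< b) c (es & is) = c (es & (a ⊖ b ∷ is))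
  assert true  (a :≡ b) c (es & is) = c ((b ⊖ a ∷ es) & is)
  assert false (a :≡ b) c (es & is) = c (es & (b ⊖ (a :+ # 1) ∷ is)) ∧ c (es & (a ⊖ (b :+ # 1) ∷ is))
  assert true  (p :× q) c s = assert true p (assert true q c) s
  assert false (p :× q) c s = assert false p c s ∧ assert false q c s
  assert true  (p :⊎ q) c s = assert true p c s ∧ assert true q c s
  assert false (p :⊎ q) c s = assert false p (assert false q c) s
  assert true  (p :⇒ q) c s = assert false p c s ∧ assert true q c s
  assert false (p :⇒ q) c s = assert true p (assert false q c) s
  assert true  :⊥       c s = true
  assert false :⊥       c s = c s

  module _ {n} (ρ : Vec ℕ n) where

    ≤-row : ∀ (a b : Expr n) → ⟦ a ⟧ ρ ≤ ⟦ b ⟧ ρ → Holds ρ (b ⊖ a)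
    ≤-row a b h = subst (0ℤ ℤ.≤_) (sym (⊖-value a b ρ)) (ℤ.i≤j⇒0≤j-i (ℤ.+≤+ h))

    <-row : ∀ (a b : Expr n) → ⟦ a ⟧ ρ < ⟦ b ⟧ ρ → Holds ρ (b ⊖ (a :+ # 1))
    <-row a b h = ≤-row (a :+ # 1) b (subst (_≤ ⟦ b ⟧ ρ) (ℕ.+-comm 1 (⟦ a ⟧ ρ)) h)

    ≡-row : ∀ (a b : Expr n) → ⟦ a ⟧ ρ ≡ ⟦ b ⟧ ρ → Vanishes ρ (b ⊖ a)
    ≡-row a b h = trans (⊖-value a b ρ) (ℤ.i≡j⇒i-j≡0 (cong +_ (sym h)))

    Refutes : (System n → Bool) → Set
    Refutes c = ∀ s → T (c s) → Satisfies ρ s → ⊥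

    Signed : Bool → Formula n → Set
    Signed true  p = ⟪ p ⟫ ρ
    Signed false p = ¬ ⟪ p ⟫ ρ

    split : ∀ {x y} → T (x ∧ y) → T x × T y
    split = Equivalence.to Bool.T-∧

    assert-sound : ∀ b p {c} → Refutes c → ∀ s → T (assert b p c s) → Signed b p → Satisfies ρ s → ⊥
    assert-sound true  (a :≤ b) k _ t h (vs & hs) = k _ t (vs & (≤-row a b h ∷ hs))
    assert-sound false (a :≤ b) k _ t h (vs & hs) = k _ t (vs & (<-row b a (ℕ.≰⇒> h) ∷ hs))
    assert-sound true  (a :< b) k _ t h (vs & hs) = k _ t (vs & (<-row a b h ∷ hs))
    assert-sound false (a :< b) k _ t h (vs & hs) = k _ t (vs & (≤-row b a (ℕ.≮⇒≥ h) ∷ hs))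
    assert-sound true  (a :≡ b) k _ t h (vs & hs) = k _ t ((≡-row a b h ∷ vs) & hs)
    assert-sound false (a :≡ b) k s t h (vs & hs) with split t
    ... | t₁ , t₂ with ℕ.≤-total (⟦ a ⟧ ρ) (⟦ b ⟧ ρ)
    ... | inj₁ l = k _ t₁ (vs & (<-row a b (ℕ.≤∧≢⇒< l h) ∷ hs))
    ... | inj₂ l = k _ t₂ (vs & (<-row b a (ℕ.≤∧≢⇒< l (h ∘ sym)) ∷ hs))
    assert-sound true  (p :× q) k s t (h , h') =
      assert-sound true p (λ s' t' → assert-sound true q k s' t' h') s t h
    assert-sound false (p :× q) k s t h hs with split t
    ... | t₁ , t₂ = assert-sound false p k s t₁
      (λ hp → assert-sound false q k s t₂ (λ hq → h (hp , hq)) hs) hs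
    assert-sound true  (p :⊎ q) {c} k s t (inj₁ h) =
      assert-sound true p k s (proj₁ (split {assert true p c s} t)) h
    assert-sound true  (p :⊎ q) {c} k s t (inj₂ h) =
      assert-sound true q k s (proj₂ (split {assert true p c s} t)) h
    assert-sound false (p :⊎ q) k s t h =
      assert-sound false p (λ s' t' → assert-sound false q k s' t' (h ∘ inj₂)) s t (h ∘ inj₁)
    assert-sound true  (p :⇒ q) k s t h hs with split t
    ... | t₁ , t₂ = assert-sound false p k s t₁ (λ hp → assert-sound true q k s t₂ (h hp) hs) hs
    assert-sound false (p :⇒ q) k s t h hs =
      h λ hp → ⊥-elim (assert-sound true p
        (λ s' t' → assert-sound false q k s' t' (λ hq → h (λ _ → hq))) s t hp hs)
    assert-sound false :⊥       k s t h = k s t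

  valid : ∀ {n} → Formula n → Bool
  valid p = assert false p refutes ([] & [])

  abstract

    -- Proof by reflection: if the negated formula is refuted by computation, the hidden argument
    -- has type `T true` and is filled in automatically. Nonlinear terms such as `a * k` are passed
    -- in `ρ` as atoms. The hypotheses of the formula become ordinary arguments.
    lia : ∀ {n} (ρ : Vec ℕ n) (p : N-ary n (Expr n) (Formula n)) →
      {_ : T (valid (p $ⁿ tabulate var))} → ⟪ p $ⁿ tabulate var ⟫ ρ
    lia {n} ρ p {t} = decidable-stable (⟪ p $ⁿ tabulate var ⟫? ρ)
      (λ h → assert-sound ρ false (p $ⁿ tabulate var) (refutes-sound ρ) _ t h ([] & []))

open LinearArithmetic using (lia; #_; _:+_; _:*_; _:≤_; _:<_; _:≡_; _:×_; _:⊎_; _:⇒_; :⊥)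

-- Bicliques and stars of powers of cycles

module Cycle (k m : ℕ) where

  n : ℕ
  n = suc m

  -- The covering map from ℕ to the cycle: a vertex is handled through any convenient position above
  -- it.
  pt : ℕ → Fin n
  pt x = x mod n

  toℕ-pt : ∀ x → toℕ (pt x) ≡ x % n
  toℕ-pt x = Fin.toℕ-fromℕ< (m%n<n x n)

  pt-+n : ∀ x → pt (x + n) ≡ pt x
  pt-+n x = Fin.toℕ-injective (trans (toℕ-pt (x + n)) (trans ([m+n]%n≡m%n x n) (sym (toℕ-pt x))))

  pt-toℕ : ∀ (v : Fin n) → pt (toℕ v) ≡ v
  pt-toℕ v = Fin.toℕ-injective (trans (toℕ-pt (toℕ v)) (m<n⇒m%n≡m (Fin.toℕ<n v)))

  -- The difference of remainders and `d` agree up to a multiple of `n`. Adding whole laps on both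
  -- sides makes them equal without any subtraction.
  modDiff-pt : ∀ x y d → y ≡ x + d → d < n → modDiff (pt x) (pt y) ≡ d
  modDiff-pt x y d y≡ d<n = begin
    (toℕ (pt y) + n ∸ toℕ (pt x)) % n  ≡⟨ cong₂ (λ a b → (a + n ∸ b) % n) (toℕ-pt y) (toℕ-pt x) ⟩
    D % n                              ≡⟨ sym ([m+kn]%n≡m%n D (y / n) n) ⟩
    (D + y / n * n) % n                ≡⟨ cong (_% n) shifted ⟩
    (d + suc (x / n) * n) % n          ≡⟨ [m+kn]%n≡m%n d (suc (x / n)) n ⟩
    d % n                              ≡⟨ m<n⇒m%n≡m d<n ⟩
    d                                  ∎
    where
    open ≡-Reasoning
    D = y % n + n ∸ x % n
    shifted : D + y / n * n ≡ d + (n + x / n * n)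
    shifted = lia (x ∷ y ∷ d ∷ D ∷ n ∷ x % n ∷ y % n ∷ x / n * n ∷ y / n * n ∷ [])
      (λ x y d D n p q i j → D :+ p :≡ q :+ n :⇒ x :≡ p :+ i :⇒ y :≡ q :+ j :⇒ y :≡ x :+ d :⇒
        D :+ j :≡ d :+ (n :+ i))
      (ℕ.m∸n+n≡m (ℕ.≤-trans (ℕ.<⇒≤ (m%n<n x n)) (ℕ.m≤n+m n (y % n))))
      (m≡m%n+[m/n]*n x n) (m≡m%n+[m/n]*n y n) y≡

  pt-unique : ∀ {x v} i → x ≡ toℕ v + i * n → v ≡ pt x
  pt-unique {x} {v} i eq = Fin.toℕ-injective (sym (trans (toℕ-pt x) (trans (cong (_% n) eq)
    (trans ([m+kn]%n≡m%n (toℕ v) i n) (m<n⇒m%n≡m (Fin.toℕ<n v))))))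

  reach : ∀ t v → ∃ λ e → e < n × v ≡ pt (t + e)
  reach t v with toℕ v ℕ.<? t % n
  ... | no p≤q = toℕ v ∸ t % n , ℕ.≤-<-trans (ℕ.m∸n≤m (toℕ v) (t % n)) (Fin.toℕ<n v) ,
    pt-unique (t / n) (lia (t ∷ toℕ v ∷ toℕ v ∸ t % n ∷ t % n ∷ t / n * n ∷ [])
      (λ t q D p i → D :+ p :≡ q :⇒ t :≡ p :+ i :⇒ t :+ D :≡ q :+ i)
      (ℕ.m∸n+n≡m (ℕ.≮⇒≥ p≤q)) (m≡m%n+[m/n]*n t n))
  -- The residue of `v` is smaller than that of `t`, so `v` is met only after passing 0, one lap
  -- later.
  ... | yes q<p = D ,
    lia (toℕ v ∷ D ∷ t % n ∷ n ∷ []) (λ q D p n → D :+ p :≡ q :+ n :⇒ q :< p :⇒ D :< n) D+p q<p ,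
    pt-unique (suc (t / n)) (lia (t ∷ toℕ v ∷ D ∷ t % n ∷ t / n * n ∷ n ∷ [])
      (λ t q D p i n → D :+ p :≡ q :+ n :⇒ t :≡ p :+ i :⇒ t :+ D :≡ q :+ (n :+ i))
      D+p (m≡m%n+[m/n]*n t n))
    where
    D = toℕ v + n ∸ t % n
    D+p : D + t % n ≡ toℕ v + n
    D+p = ℕ.m∸n+n≡m (ℕ.≤-trans (ℕ.<⇒≤ (m%n<n t n)) (ℕ.m≤n+m n (toℕ v)))

  -- Within one lap there are two ways to be at distance at most k: forwards from `a` to `b`, or
  -- onwards from `b` to the next copy of `a`.
  Ahead : ℕ → ℕ → Set
  Ahead a b = a < b × (b ≤ a + k ⊎ a + n ≤ b + k)

  Near : ℕ → ℕ → Set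
  Near a b = Ahead a b ⊎ Ahead b a

  Adj-sym : ∀ {x y : Fin n} → Adj k x y → Adj k y x
  Adj-sym {x} {y} (x≢y , h) = x≢y ∘ sym , subst (_≤ k) (ℕ.⊓-comm (modDiff x y) (modDiff y x)) h

  Adj-irrefl : ∀ {x : Fin n} → ¬ Adj k x x
  Adj-irrefl (x≢x , _) = x≢x refl

  module _ {a b : ℕ} (a<b : a < b) (b<a+n : b < a + n) where

    private
      d e : ℕ
      d = b ∸ a
      e = a + n ∸ b
      d+a : d + a ≡ b
      d+a = ℕ.m∸n+n≡m (ℕ.<⇒≤ a<b)
      e+b : e + b ≡ a + n
      e+b = ℕ.m∸n+n≡m (ℕ.<⇒≤ b<a+n)

      forward : modDiff (pt a) (pt b) ≡ d
      forward = modDiff-pt a b d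
        (lia (a ∷ b ∷ d ∷ []) (λ a b d → d :+ a :≡ b :⇒ b :≡ a :+ d) d+a)
        (lia (a ∷ b ∷ d ∷ n ∷ []) (λ a b d n → d :+ a :≡ b :⇒ b :< a :+ n :⇒ d :< n) d+a b<a+n)

      backward : modDiff (pt b) (pt a) ≡ e
      backward = trans (cong (modDiff (pt b)) (sym (pt-+n a))) (modDiff-pt b (a + n) e
        (lia (a ∷ b ∷ e ∷ n ∷ []) (λ a b e n → e :+ b :≡ a :+ n :⇒ a :+ n :≡ b :+ e) e+b)
        (lia (a ∷ b ∷ e ∷ n ∷ []) (λ a b e n → e :+ b :≡ a :+ n :⇒ a :< b :⇒ e :< n) e+b a<b))

    pt-≢ : pt a ≢ pt b
    pt-≢ eq = lia (a ∷ b ∷ d ∷ []) (λ a b d → d :≡ # 0 :⇒ d :+ a :≡ b :⇒ a :< b :⇒ :⊥)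
      (trans (sym forward) (trans (cong (modDiff (pt a)) (sym eq))
        (modDiff-pt a a 0 (sym (ℕ.+-identityʳ a)) (s≤s z≤n)))) d+a a<b

    Adj⇒Ahead : Adj k (pt a) (pt b) → Ahead a b
    Adj⇒Ahead (_ , h) = a<b ,
      [ (λ eq → inj₁ (short (subst (_≤ k) eq d⊓e≤k))) , (λ eq → inj₂ (long (subst (_≤ k) eq d⊓e≤k))) ]′
      (ℕ.⊓-sel d e)
      where
      d⊓e≤k : d ⊓ e ≤ k
      d⊓e≤k = subst (_≤ k) (cong₂ _⊓_ forward backward) h
      short : d ≤ k → b ≤ a + k
      short l = lia (a ∷ b ∷ d ∷ k ∷ []) (λ a b d k → d :≤ k :⇒ d :+ a :≡ b :⇒ b :≤ a :+ k) l d+a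
      long : e ≤ k → a + n ≤ b + k
      long l = lia (a ∷ b ∷ e ∷ k ∷ n ∷ []) (λ a b e k n → e :≤ k :⇒ e :+ b :≡ a :+ n :⇒ a :+ n :≤ b :+ k) l e+b

    Ahead⇒Adj : Ahead a b → Adj k (pt a) (pt b)
    Ahead⇒Adj (_ , h) = pt-≢ , subst (_≤ k) (sym (cong₂ _⊓_ forward backward)) ([
      (λ l → ℕ.m≤n⇒m⊓o≤n e
        (lia (a ∷ b ∷ d ∷ k ∷ []) (λ a b d k → b :≤ a :+ k :⇒ d :+ a :≡ b :⇒ d :≤ k) l d+a)) ,
      (λ l → ℕ.m≤n⇒o⊓m≤n d
        (lia (a ∷ b ∷ e ∷ k ∷ n ∷ []) (λ a b e k n → a :+ n :≤ b :+ k :⇒ e :+ b :≡ a :+ n :⇒ e :≤ k) l e+b)) ]′ h)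

  module _ {a b : ℕ} (a<b+n : a < b + n) (b<a+n : b < a + n) where

    Adj⇒Near : Adj k (pt a) (pt b) → Near a b
    Adj⇒Near h with ℕ.<-cmp a b
    ... | tri< a<b _ _ = inj₁ (Adj⇒Ahead a<b b<a+n h)
    ... | tri≈ _ a≡b _ = ⊥-elim (proj₁ h (cong pt a≡b))
    ... | tri> _ _ b<a = inj₂ (Adj⇒Ahead b<a a<b+n (Adj-sym h))

    Near⇒Adj : Near a b → Adj k (pt a) (pt b)
    Near⇒Adj (inj₁ h@(a<b , _)) = Ahead⇒Adj a<b b<a+n h
    Near⇒Adj (inj₂ h@(b<a , _)) = Adj-sym (Ahead⇒Adj b<a a<b+n h)

  Right Left Close : ℕ → ℕ → Set
  Right t y = t < y × y ≤ t + k
  Left  t y = y < t × t ≤ y + k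
  Close t y = Right t y ⊎ Left t y

  pt-lap : ∀ u → pt (toℕ u + n) ≡ u
  pt-lap u = trans (pt-+n (toℕ u)) (pt-toℕ u)

  -- One lap is added to the position of u, so that going back k steps does not truncate at 0.
  neighbour : ∀ {u v} → Adj k u v → ∃ λ y → v ≡ pt y × Close (toℕ u + n) y
  neighbour {u} {v} adj with reach (toℕ u + n) v
  ... | e , e<n , refl = position (Adj⇒Near
      (lia (t ∷ e ∷ n ∷ []) (λ t e n → e :< n :⇒ t :< t :+ e :+ n) e<n)
      (lia (t ∷ e ∷ n ∷ []) (λ t e n → e :< n :⇒ t :+ e :< t :+ n) e<n)
      (subst (λ w → Adj k w (pt (t + e))) (sym (pt-lap u)) adj))
    where
    t y : ℕ
    t = toℕ u + n
    y = t + e ∸ n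
    y+n : y + n ≡ t + e
    y+n = ℕ.m∸n+n≡m (ℕ.≤-trans (ℕ.m≤n+m n (toℕ u)) (ℕ.m≤m+n t e))
    position : Near t (t + e) → ∃ λ y → pt (t + e) ≡ pt y × Close t y
    position (inj₁ (t<t+e , inj₁ l)) = t + e , refl , inj₁ (t<t+e , l)
    position (inj₁ (_ , inj₂ l)) = y , trans (cong pt (sym y+n)) (pt-+n y) , inj₂
      (lia (t ∷ e ∷ n ∷ k ∷ y ∷ [])
        (λ t e n k y → y :+ n :≡ t :+ e :⇒ e :< n :⇒ t :+ n :≤ t :+ e :+ k :⇒ (y :< t :× t :≤ y :+ k))
        y+n e<n l)
    position (inj₂ (t+e<t , _)) = ⊥-elim (ℕ.m+n≮m t e t+e<t)

  -- Induced paths and small complete bipartite sets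

  Path : Fin n → Fin n → Fin n → Set
  Path x u y = Adj k u x × Adj k u y × ¬ Adj k x y × x ≢ y

  Bipartite : Subset n → Set
  Bipartite = InducesCompleteBipartite k

  -- The ends of an edge lie in different parts, and `c` shares its part with one of them. The
  -- maximality arguments use this in place of the parts themselves.
  opposite-parts : ∀ {S a b c} → Bipartite S → a ∈ S → b ∈ S → c ∈ S → Adj k a b →
    (Adj k a c × ¬ Adj k b c) ⊎ (Adj k b c × ¬ Adj k a c)
  opposite-parts {a = a} {b} {c} (A , B , cover , _ , _ , _ , _ , _ , adj , indepA , indepB) a∈S b∈S c∈S ab
    with cover a a∈S | cover b b∈S | cover c c∈S
  ... | inj₁ a∈A | inj₁ b∈A | _        = ⊥-elim (indepA a b a∈A b∈A ab)
  ... | inj₂ a∈B | inj₂ b∈B | _        = ⊥-elim (indepB a b a∈B b∈B ab)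
  ... | inj₁ a∈A | inj₂ b∈B | inj₁ c∈A = inj₂ (Adj-sym (adj c b c∈A b∈B) , indepA a c a∈A c∈A)
  ... | inj₁ a∈A | inj₂ b∈B | inj₂ c∈B = inj₁ (adj a c a∈A c∈B , indepB b c b∈B c∈B)
  ... | inj₂ a∈B | inj₁ b∈A | inj₁ c∈A = inj₁ (Adj-sym (adj c a c∈A a∈B) , indepA b c b∈A c∈A)
  ... | inj₂ a∈B | inj₁ b∈A | inj₂ c∈B = inj₂ (adj b c b∈A c∈B , indepB a c a∈B c∈B)

  pair : Fin n → Fin n → Subset n
  pair u w = ⁅ u ⁆ ∪ ⁅ w ⁆

  ∈-pair⁻ : ∀ {u w v} → v ∈ pair u w → v ≡ u ⊎ v ≡ w
  ∈-pair⁻ {u} {w} h = Sum.map (x∈⁅y⁆⇒x≡y u) (x∈⁅y⁆⇒x≡y w) (x∈p∪q⁻ ⁅ u ⁆ ⁅ w ⁆ h)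

  ∈-pair⁺ : ∀ {u w v} → v ≡ u ⊎ v ≡ w → v ∈ pair u w
  ∈-pair⁺ (inj₁ refl) = x∈p∪q⁺ (inj₁ (x∈⁅x⁆ _))
  ∈-pair⁺ (inj₂ refl) = x∈p∪q⁺ (inj₂ (x∈⁅x⁆ _))

  -- The complete bipartite set with parts {u, w} and {x, y}, where u = w is allowed.
  quad : Fin n → Fin n → Fin n → Fin n → Subset n
  quad u w x y = pair u w ∪ pair x y

  ∈-quad⁻ : ∀ {u w x y v} → v ∈ quad u w x y → (v ≡ u ⊎ v ≡ w) ⊎ (v ≡ x ⊎ v ≡ y)
  ∈-quad⁻ {u} {w} {x} {y} h = Sum.map ∈-pair⁻ ∈-pair⁻ (x∈p∪q⁻ (pair u w) (pair x y) h)

  ∈-quad⁺ : ∀ {u w x y v} → (v ≡ u ⊎ v ≡ w) ⊎ (v ≡ x ⊎ v ≡ y) → v ∈ quad u w x y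
  ∈-quad⁺ h = x∈p∪q⁺ (Sum.map ∈-pair⁺ ∈-pair⁺ h)

  quad-monochromatic : ∀ {c} (f : Fin n → Fin c) {u w x y} → f w ≡ f u → f x ≡ f u → f y ≡ f u →
    Monochromatic f (quad u w x y)
  quad-monochromatic f {u} {w} {x} {y} w≡u x≡u y≡u = f u , colours
    where
    colours : ∀ v → v ∈ quad u w x y → f v ≡ f u
    colours v v∈ with ∈-quad⁻ v∈
    ... | inj₁ (inj₁ refl) = refl
    ... | inj₁ (inj₂ refl) = w≡u
    ... | inj₂ (inj₁ refl) = x≡u
    ... | inj₂ (inj₂ refl) = y≡u

  quad-bipartite : ∀ {u w x y} → Adj k u x → Adj k u y → Adj k w x → Adj k w y →
    ¬ Adj k u w → ¬ Adj k x y → Bipartite (quad u w x y)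
  quad-bipartite {u} {w} {x} {y} ux uy wx wy uw xy =
    pair u w , pair x y ,
    (λ v → x∈p∪q⁻ (pair u w) (pair x y)) , (λ v → x∈p∪q⁺ ∘ inj₁) , (λ v → x∈p∪q⁺ ∘ inj₂) ,
    (λ v v∈A v∈B → Adj-irrefl (across v∈A v∈B)) ,
    (u , ∈-pair⁺ (inj₁ refl)) , (x , ∈-pair⁺ (inj₁ refl)) ,
    (λ a b → across) , (λ a b → independent uw) , (λ a b → independent xy)
    where
    across : ∀ {a b} → a ∈ pair u w → b ∈ pair x y → Adj k a b
    across a∈ b∈ with ∈-pair⁻ a∈ | ∈-pair⁻ b∈
    ... | inj₁ refl | inj₁ refl = ux
    ... | inj₁ refl | inj₂ refl = uy
    ... | inj₂ refl | inj₁ refl = wx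
    ... | inj₂ refl | inj₂ refl = wy
    independent : ∀ {p q a b} → ¬ Adj k p q → a ∈ pair p q → b ∈ pair p q → ¬ Adj k a b
    independent pq a∈ b∈ ab with ∈-pair⁻ a∈ | ∈-pair⁻ b∈
    ... | inj₁ refl | inj₁ refl = Adj-irrefl ab
    ... | inj₁ refl | inj₂ refl = pq ab
    ... | inj₂ refl | inj₁ refl = pq (Adj-sym ab)
    ... | inj₂ refl | inj₂ refl = Adj-irrefl ab

  path-star : ∀ {x u y} → Path x u y → InducesStar k (quad u u x y)
  path-star {x} {u} {y} (ux , uy , xy , _) =
    quad-bipartite ux uy ux uy Adj-irrefl xy , u , ∈-quad⁺ (inj₁ (inj₁ refl)) , universal
    where
    universal : ∀ v → v ∈ quad u u x y → v ≢ u → Adj k u v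
    universal v v∈ v≢u with ∈-quad⁻ v∈
    ... | inj₁ (inj₁ refl) = ⊥-elim (v≢u refl)
    ... | inj₁ (inj₂ refl) = ⊥-elim (v≢u refl)
    ... | inj₂ (inj₁ refl) = ux
    ... | inj₂ (inj₂ refl) = uy

  -- Claw-freeness and maximal sets

  module _ (2k+2≤n : 2 * k + 2 ≤ n) where

    Close⇒Adj : ∀ {t y} → Close t y → Adj k (pt t) (pt y)
    Close⇒Adj {t} {y} (inj₁ (t<y , l)) = Ahead⇒Adj t<y
      (lia (t ∷ y ∷ k ∷ n ∷ []) (λ t y k n → y :≤ t :+ k :⇒ 2 :* k :+ # 2 :≤ n :⇒ y :< t :+ n) l 2k+2≤n)
      (t<y , inj₁ l)
    Close⇒Adj {t} {y} (inj₂ (y<t , l)) = Adj-sym (Ahead⇒Adj y<t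
      (lia (t ∷ y ∷ k ∷ n ∷ []) (λ t y k n → t :≤ y :+ k :⇒ 2 :* k :+ # 2 :≤ n :⇒ t :< y :+ n) l 2k+2≤n)
      (y<t , inj₁ l))

    private
      within-2k : ∀ {t a b} → Close t a → Close t b → a < b + n
      within-2k {t} {a} {b} = lia (t ∷ a ∷ b ∷ k ∷ n ∷ []) (λ t a b k n → 2 :* k :+ # 2 :≤ n :⇒
        (t :< a :× a :≤ t :+ k) :⊎ (a :< t :× t :≤ a :+ k) :⇒
        (t :< b :× b :≤ t :+ k) :⊎ (b :< t :× t :≤ b :+ k) :⇒ a :< b :+ n) 2k+2≤n

    -- Distinct positions at most k apart would be adjacent. Claw-freeness applies this to two
    -- neighbours on the same side, the arc colourings to two neighbours in the same block.
    independent⇒≡ : ∀ {t a b} → Close t a → Close t b → a ≤ b + k → b ≤ a + k → ¬ Adj k (pt a) (pt b) → a ≡ b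
    independent⇒≡ {t} {a} {b} ta tb a≤b+k b≤a+k ab with ℕ.<-cmp a b
    ... | tri< a<b _ _ = ⊥-elim (ab (Ahead⇒Adj a<b (within-2k tb ta) (a<b , inj₁ b≤a+k)))
    ... | tri≈ _ a≡b _ = a≡b
    ... | tri> _ _ b<a = ⊥-elim (ab (Adj-sym (Ahead⇒Adj b<a (within-2k ta tb) (b<a , inj₁ a≤b+k))))

    private
      right-right : ∀ {t a b} → Right t a → Right t b → a ≤ b + k
      right-right {t} {a} {b} = lia (t ∷ a ∷ b ∷ k ∷ [])
        (λ t a b k → (t :< a :× a :≤ t :+ k) :⇒ (t :< b :× b :≤ t :+ k) :⇒ a :≤ b :+ k)
      left-left : ∀ {t a b} → Left t a → Left t b → a ≤ b + k
      left-left {t} {a} {b} = lia (t ∷ a ∷ b ∷ k ∷ [])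
        (λ t a b k → (a :< t :× t :≤ a :+ k) :⇒ (b :< t :× t :≤ b :+ k) :⇒ a :≤ b :+ k)

    -- Two independent neighbours of a vertex lie on different sides of it, so there are no three.
    claw-free : ∀ {u x y z} → Adj k u x → Adj k u y → Adj k u z →
      ¬ Adj k x y → ¬ Adj k x z → ¬ Adj k y z → x ≡ y ⊎ x ≡ z ⊎ y ≡ z
    claw-free {u} ux uy uz xy xz yz with neighbour ux | neighbour uy | neighbour uz
    ... | a , refl , ca | b , refl , cb | c , refl , cc = sides ca cb cc
      where
      t = toℕ u + n
      same : ∀ {a b} → (Right t a × Right t b) ⊎ (Left t a × Left t b) → ¬ Adj k (pt a) (pt b) → pt a ≡ pt b
      same (inj₁ (p , q)) h = cong pt (independent⇒≡ (inj₁ p) (inj₁ q) (right-right p q) (right-right q p) h)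
      same (inj₂ (p , q)) h = cong pt (independent⇒≡ (inj₂ p) (inj₂ q) (left-left p q) (left-left q p) h)
      sides : Close t a → Close t b → Close t c → pt a ≡ pt b ⊎ pt a ≡ pt c ⊎ pt b ≡ pt c
      sides (inj₁ p) (inj₁ q) _        = inj₁ (same (inj₁ (p , q)) xy)
      sides (inj₂ p) (inj₂ q) _        = inj₁ (same (inj₂ (p , q)) xy)
      sides (inj₁ p) (inj₂ _) (inj₁ r) = inj₂ (inj₁ (same (inj₁ (p , r)) xz))
      sides (inj₁ _) (inj₂ q) (inj₂ r) = inj₂ (inj₂ (same (inj₂ (q , r)) yz))
      sides (inj₂ _) (inj₁ q) (inj₁ r) = inj₂ (inj₂ (same (inj₁ (q , r)) yz))
      sides (inj₂ p) (inj₁ _) (inj₂ r) = inj₂ (inj₁ (same (inj₂ (p , r)) xz))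

    -- Shared by stars and bicliques, and by paths (`u` = `w`) and squares. A vertex `v` of a larger
    -- set that is adjacent to `u` shares the part of `x` and `y`, and claw-freeness at `u` makes it
    -- one of them. Otherwise it shares the part of `u` and `w`, and that case is left to `other`.
    quad-maximal : ∀ {P : Subset n → Set} → (∀ {T} → P T → Bipartite T) → ∀ {u w x y} →
      Adj k u x → Adj k u y → Adj k w x → Adj k w y → ¬ Adj k u w → ¬ Adj k x y → x ≢ y → P (quad u w x y) →
      (∀ {T v} → P T → quad u w x y ⊆ T → v ∈ T →
        Adj k x v → Adj k y v → ¬ Adj k u v → ¬ Adj k w v → v ≡ u ⊎ v ≡ w) →
      Maximal P (quad u w x y)
    quad-maximal {P} bip {u} {w} {x} {y} ux uy wx wy uw xy x≢y p other = p , maximal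
      where
      maximal : ∀ T → quad u w x y ⊆ T → P T → T ⊆ quad u w x y
      maximal T S⊆T pT {v} v∈T = ∈-quad⁺ (part
        (opposite-parts (bip pT) u∈T x∈T v∈T ux) (opposite-parts (bip pT) u∈T y∈T v∈T uy)
        (opposite-parts (bip pT) w∈T x∈T v∈T wx))
        where
        u∈T : u ∈ T
        u∈T = S⊆T (∈-quad⁺ (inj₁ (inj₁ refl)))
        w∈T : w ∈ T
        w∈T = S⊆T (∈-quad⁺ (inj₁ (inj₂ refl)))
        x∈T : x ∈ T
        x∈T = S⊆T (∈-quad⁺ (inj₂ (inj₁ refl)))
        y∈T : y ∈ T
        y∈T = S⊆T (∈-quad⁺ (inj₂ (inj₂ refl)))
        part : (Adj k u v × ¬ Adj k x v) ⊎ (Adj k x v × ¬ Adj k u v) →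
               (Adj k u v × ¬ Adj k y v) ⊎ (Adj k y v × ¬ Adj k u v) →
               (Adj k w v × ¬ Adj k x v) ⊎ (Adj k x v × ¬ Adj k w v) →
               (v ≡ u ⊎ v ≡ w) ⊎ (v ≡ x ⊎ v ≡ y)
        part (inj₁ (uv , xv)) (inj₁ (_ , yv)) _ with claw-free ux uy uv xy xv yv
        ... | inj₁ x≡y        = ⊥-elim (x≢y x≡y)
        ... | inj₂ (inj₁ x≡v) = inj₂ (inj₁ (sym x≡v))
        ... | inj₂ (inj₂ y≡v) = inj₂ (inj₂ (sym y≡v))
        part (inj₁ (uv , _)) (inj₂ (_ , ¬uv)) _ = ⊥-elim (¬uv uv)
        part (inj₂ (_ , ¬uv)) (inj₁ (uv , _)) _ = ⊥-elim (¬uv uv)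
        part (inj₂ (xv , _)) (inj₂ _) (inj₁ (_ , ¬xv)) = ⊥-elim (¬xv xv)
        part (inj₂ (xv , ¬uv)) (inj₂ (yv , _)) (inj₂ (_ , ¬wv)) = inj₁ (other pT S⊆T v∈T xv yv ¬uv ¬wv)

    path-isStar : ∀ {x u y} → Path x u y → IsStar k (quad u u x y)
    path-isStar {x} {u} {y} path@(ux , uy , xy , x≢y) =
      quad-maximal proj₁ ux uy ux uy Adj-irrefl xy x≢y (path-star path) no-other
      where
      no-other : ∀ {T v} → InducesStar k T → quad u u x y ⊆ T → v ∈ T →
        Adj k x v → Adj k y v → ¬ Adj k u v → ¬ Adj k u v → v ≡ u ⊎ v ≡ u
      no-other {T} {v} (bip , c , c∈T , universal) S⊆T v∈T _ _ ¬uv _ with v Fin.≟ u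
      ... | yes v≡u = inj₁ v≡u
      -- The centre `c` of `T` is neither `u`, which is not adjacent to `v`, nor `x`, which is not
      -- adjacent to `y`. So `u`, `x`, `c` would form a triangle in a bipartite set.
      ... | no  v≢u = ⊥-elim (
        [ (λ (_ , ¬xc) → ¬xc xc) , (λ (_ , ¬uc) → ¬uc uc) ]′
        (opposite-parts bip u∈T x∈T c∈T ux))
        where
        u∈T : u ∈ T
        u∈T = S⊆T (∈-quad⁺ (inj₁ (inj₁ refl)))
        x∈T : x ∈ T
        x∈T = S⊆T (∈-quad⁺ (inj₂ (inj₁ refl)))
        y∈T : y ∈ T
        y∈T = S⊆T (∈-quad⁺ (inj₂ (inj₂ refl)))
        uc : Adj k u c
        uc = Adj-sym (universal u u∈T (λ { refl → ¬uv (universal v v∈T v≢u) }))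
        xc : Adj k x c
        xc = Adj-sym (universal x x∈T (λ { refl → xy (universal y y∈T (x≢y ∘ sym)) }))

    -- Here claw-freeness works on both parts: `x` is adjacent to `u`, `w` and any new vertex beside
    -- them.
    square-isBiclique : ∀ {u w x y} → Adj k u x → Adj k u y → Adj k w x → Adj k w y →
      ¬ Adj k u w → ¬ Adj k x y → u ≢ w → x ≢ y → IsBiclique k (quad u w x y)
    square-isBiclique {u} {w} {x} ux uy wx wy uw xy u≢w x≢y =
      quad-maximal (λ b → b) ux uy wx wy uw xy x≢y (quad-bipartite ux uy wx wy uw xy) no-other
      where
      no-other : ∀ {T v} → Bipartite T → _ → v ∈ T → Adj k x v → _ → ¬ Adj k u v → ¬ Adj k w v → v ≡ u ⊎ v ≡ w
      no-other _ _ _ xv _ uv wv with claw-free (Adj-sym ux) (Adj-sym wx) xv uw uv wv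
      ... | inj₁ u≡w        = ⊥-elim (u≢w u≡w)
      ... | inj₂ (inj₁ u≡v) = inj₁ (sym u≡v)
      ... | inj₂ (inj₂ w≡v) = inj₂ (sym w≡v)

    path-isBiclique : ∀ {x u y} → Path x u y → (∀ v → Adj k x v → Adj k y v → ¬ Adj k u v → v ≡ u) →
      IsBiclique k (quad u u x y)
    path-isBiclique path@(ux , uy , xy , x≢y) other = quad-maximal (λ b → b) ux uy ux uy Adj-irrefl xy x≢y
      (proj₁ (path-star path)) (λ _ _ _ xv yv uv _ → inj₁ (other _ xv yv uv))

    pt-path : ∀ {x u y} → Left u x → Right u y → x + k < y → y + k < x + n → Path (pt x) (pt u) (pt y)
    pt-path {x} {u} {y} l@(x<u , _) r@(u<y , _) far far' =
      Close⇒Adj (inj₂ l) , Close⇒Adj (inj₁ r) ,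
      (λ xy → lia (x ∷ y ∷ k ∷ n ∷ []) (λ x y k n → x :+ k :< y :⇒ y :+ k :< x :+ n :⇒
        y :≤ x :+ k :⊎ x :+ n :≤ y :+ k :⇒ :⊥) far far' (proj₂ (Adj⇒Ahead x<y y<x+n xy))) ,
      pt-≢ x<y y<x+n
      where
      x<y : x < y
      x<y = ℕ.<-trans x<u u<y
      y<x+n : y < x + n
      y<x+n = ℕ.≤-<-trans (ℕ.m≤m+n y k) far'

    -- The arc from `y` on to the next copy of `x` is longer than 2k and contains no common
    -- neighbour of the ends. A common neighbour between `x` and `y` lies within k to the right of
    -- `x`, as `u` does, so it is adjacent or equal to `u`.
    pt-path-isBiclique : ∀ {x u y} → Left u x → Right u y → x + k < y → y + k + k < x + n →
      IsBiclique k (quad (pt u) (pt u) (pt x) (pt y))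
    pt-path-isBiclique {x} {u} {y} l@(x<u , u≤x+k) r far far' = path-isBiclique
      (pt-path l r far (ℕ.≤-<-trans (ℕ.m≤m+n (y + k) k) far')) other
      where
      other : ∀ v → Adj k (pt x) v → Adj k (pt y) v → ¬ Adj k (pt u) v → v ≡ pt u
      other v xv yv uv with reach x v
      ... | e , e<n , refl = cong pt (sym (independent⇒≡ (inj₁ (x<u , u≤x+k)) (inj₁ z-right)
        (lia (x ∷ u ∷ z ∷ k ∷ []) (λ x u z k → u :≤ x :+ k :⇒ x :< z :× z :≤ x :+ k :⇒ u :≤ z :+ k) u≤x+k z-right)
        (lia (x ∷ u ∷ z ∷ k ∷ []) (λ x u z k → x :< u :⇒ x :< z :× z :≤ x :+ k :⇒ z :≤ u :+ k) x<u z-right) uv))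
        where
        z : ℕ
        z = x + e
        z-right : Right x z
        z-right = lia (x ∷ y ∷ z ∷ k ∷ n ∷ [])
          (λ x y z k n → x :+ k :< y :⇒ y :+ k :+ k :< x :+ n :⇒ x :≤ z :⇒ z :< x :+ n :⇒
            (x :< z :× (z :≤ x :+ k :⊎ x :+ n :≤ z :+ k)) :⊎ (z :< x :× (x :≤ z :+ k :⊎ z :+ n :≤ x :+ k)) :⇒
            (y :< z :× (z :≤ y :+ k :⊎ y :+ n :≤ z :+ k)) :⊎ (z :< y :× (y :≤ z :+ k :⊎ z :+ n :≤ y :+ k)) :⇒
            x :< z :× z :≤ x :+ k)
          far far' (ℕ.m≤m+n x e) (ℕ.+-monoʳ-< x e<n)
          (Adj⇒Near (lia (x ∷ e ∷ n ∷ []) (λ x e n → e :< n :⇒ x :< x :+ e :+ n) e<n) (ℕ.+-monoʳ-< x e<n) xv)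
          (Adj⇒Near (lia (x ∷ y ∷ e ∷ k ∷ n ∷ []) (λ x y e k n → y :+ k :+ k :< x :+ n :⇒ y :< x :+ e :+ n) far')
            (lia (x ∷ y ∷ e ∷ k ∷ n ∷ []) (λ x y e k n → x :+ k :< y :⇒ e :< n :⇒ x :+ e :< y :+ n) far e<n) yv)

    private
      span>k : ∀ x → x + k < x + suc k
      span>k x = ℕ.+-monoʳ-< x (ℕ.n<1+n k)
      span<n-k : ∀ x → x + suc k + k < x + n
      span<n-k x = lia (x ∷ k ∷ n ∷ [])
        (λ x k n → 2 :* k :+ # 2 :≤ n :⇒ x :+ (# 1 :+ k) :+ k :< x :+ n) 2k+2≤n

    -- The position k+1 steps after the earlier end is just out of its reach, but within reach of
    -- the later end. Since n ≥ 2k+2, it is out of reach the other way round too.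
    extend-edge : ∀ {a b} → Adj k a b → (∃ λ z → Path a b z) ⊎ (∃ λ z → Path b a z)
    extend-edge {a} ab with neighbour ab
    ... | y , refl , inj₁ (t<y , l) = inj₁ (pt (t + suc k) ,
      subst (λ w → Path w (pt y) (pt (t + suc k))) (pt-lap a) (pt-path (t<y , l)
        (lia (t ∷ y ∷ k ∷ []) (λ t y k → t :< y :⇒ y :≤ t :+ k :⇒
          y :< t :+ (# 1 :+ k) :× t :+ (# 1 :+ k) :≤ y :+ k) t<y l)
        (span>k t) (span<n-k t)))
      where
      t : ℕ
      t = toℕ a + n
    ... | y , refl , inj₂ (y<t , l) = inj₂ (pt (y + suc k) ,
      subst (λ w → Path (pt y) w (pt (y + suc k))) (pt-lap a) (pt-path (y<t , l)
        (lia (t ∷ y ∷ k ∷ []) (λ t y k → y :< t :⇒ t :≤ y :+ k :⇒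
          t :< y :+ (# 1 :+ k) :× y :+ (# 1 :+ k) :≤ t :+ k) y<t l)
        (span>k y) (span<n-k y)))
      where
      t : ℕ
      t = toℕ a + n

    -- A third element of S either exists or can be added, since every edge extends to a path.
    maximal-contains-path : ∀ {P : Subset n → Set} →
      (∀ {T} → P T → Bipartite T) → (∀ {T} → InducesStar k T → P T) →
      ∀ {S} → Maximal P S → ∃ λ x → ∃ λ u → ∃ λ y → Path x u y × x ∈ S × u ∈ S × y ∈ S
    maximal-contains-path {P} bip star {S} (pS , maximal) with bip pS
    ... | A , B , _ , A⊆S , B⊆S , _ , (a , a∈A) , (b , b∈B) , adj , _ = from-edge (extend-edge ab)
      where
      ab : Adj k a b
      ab = adj a b a∈A b∈B

      Goal : Set
      Goal = ∃ λ x → ∃ λ u → ∃ λ y → Path x u y × x ∈ S × u ∈ S × y ∈ S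

      extended : ∀ {a b z} → Adj k a b → a ∈ S → b ∈ S → Path a b z → Goal
      extended {a} {b} {z} ab a∈S b∈S path
        with Fin.any? (λ w → w ∈? S ×-dec ¬? (w Fin.≟ a) ×-dec ¬? (w Fin.≟ b))
      ... | no none = a , b , z , path , a∈S , b∈S ,
        maximal (quad b b a z) S⊆T (star (path-star path)) (∈-quad⁺ (inj₂ (inj₂ refl)))
        where
        S⊆T : S ⊆ quad b b a z
        S⊆T {w} w∈S with w Fin.≟ a | w Fin.≟ b
        ... | yes w≡a | _       = ∈-quad⁺ (inj₂ (inj₁ w≡a))
        ... | no _    | yes w≡b = ∈-quad⁺ (inj₁ (inj₁ w≡b))
        ... | no w≢a  | no w≢b  = ⊥-elim (none (w , w∈S , w≢a , w≢b))
      ... | yes (w , w∈S , w≢a , w≢b) with opposite-parts (bip pS) a∈S b∈S w∈S ab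
      ...   | inj₁ (aw , bw) = b , a , w , (ab , aw , bw , w≢b ∘ sym) , b∈S , a∈S , w∈S
      ...   | inj₂ (bw , aw) = a , b , w , (Adj-sym ab , bw , aw , w≢a ∘ sym) , a∈S , b∈S , w∈S

      from-edge : (∃ λ z → Path a b z) ⊎ (∃ λ z → Path b a z) → Goal
      from-edge (inj₁ (_ , path)) = extended ab (A⊆S a a∈A) (B⊆S b b∈B) path
      from-edge (inj₂ (_ , path)) = extended (Adj-sym ab) (B⊆S b b∈B) (A⊆S a a∈A) path

    -- Colourings without monochromatic paths

    PathColouring : ∀ {c} → (Fin n → Fin c) → Set
    PathColouring f = ∀ {x u y} → Path x u y → f x ≡ f u → f y ≡ f u → ⊥

    star⇒path : ∀ {c} {f : Fin n → Fin c} → StarColouring k f → PathColouring f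
    star⇒path {f = f} col path x≡u y≡u = col _ (path-isStar path) (quad-monochromatic f refl x≡u y≡u)

    private
      path⇒ : ∀ {P : Subset n → Set} → (∀ {T} → P T → Bipartite T) → (∀ {T} → InducesStar k T → P T) →
        ∀ {c} {f : Fin n → Fin c} → PathColouring f → ∀ S → Maximal P S → ¬ Monochromatic f S
      path⇒ bip star col S max (c , mono) with maximal-contains-path bip star max
      ... | x , u , y , path , x∈S , u∈S , y∈S =
        col path (trans (mono x x∈S) (sym (mono u u∈S))) (trans (mono y y∈S) (sym (mono u u∈S)))

    path⇒star : ∀ {c} {f : Fin n → Fin c} → PathColouring f → StarColouring k f
    path⇒star = path⇒ proj₁ (λ s → s)

    path⇒biclique : ∀ {c} {f : Fin n → Fin c} → PathColouring f → BicliqueColouring k f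
    path⇒biclique = path⇒ (λ b → b) proj₁

-- Monochromatic arcs of 2-colourings

≢⇒≡not : ∀ {a b} → a ≢ b → b ≡ not a
≢⇒≡not a≢b = Bool.¬-not (a≢b ∘ sym)

both-≢⇒≡ : ∀ {a b c : Bool} → a ≢ c → b ≢ c → a ≡ b
both-≢⇒≡ a≢c b≢c = trans (Bool.¬-not a≢c) (sym (Bool.¬-not b≢c))

alternate : ℕ → Bool → Bool
alternate zero    x = x
alternate (suc i) x = alternate i (not x)

alternate-even : ∀ i x → alternate i x ≡ x → 2 ∣ i
alternate-even zero          x     h = 2 ∣0
alternate-even (suc zero)    true  ()
alternate-even (suc zero)    false ()
alternate-even (suc (suc i)) x     h
  with alternate-even i x (trans (sym (cong (alternate i) (Bool.not-involutive x))) h)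
... | divides q i≡q*2 = divides (suc q) (cong (2 +_) i≡q*2)

-- The fourth point `z` is the corner that completes a path of span k+2 to a square when n = 3k+2;
-- with it, one argument covers star- and biclique-colourings.
module TwoColours (k : ℕ) (1≤k : 1 ≤ k) (g : ℕ → Bool)
  (span-k+1 : ∀ x u y → x < u → u ≤ x + k → y ≡ x + suc k → g x ≡ g u → g y ≡ g u → ⊥)
  (span-k+2 : ∀ x u y z → 2 + x ≤ u → u ≤ x + k → y ≡ x + (2 + k) → z ≡ x + (2 * k + 2) →
    g x ≡ g u → g y ≡ g u → g z ≡ g u → ⊥) where

  Boundary : ℕ → Set
  Boundary i = g i ≢ g (suc i)

  module _ {i} (bd : Boundary i) where

    private
      -- If the block after i ended before u, the colours would repeat with the opposite sign
      -- after k + 1 steps, and i, u, i + k + 2, i + 2k + 2 would have the same colour.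
      short-block-impossible : ∀ u → 2 + i ≤ u → u ≤ i + k → g u ≢ g (suc i) → ⊥
      short-block-impossible u 2+i≤u u≤i+k u≢b =
        span-k+2 i u (i + (2 + k)) (i + (2 * k + 2)) 2+i≤u u≤i+k refl refl
          i≡u (both-≢⇒≡ p₂ u≢b) (both-≢⇒≡ p₄ u≢b)
        where
        i≡u : g i ≡ g u
        i≡u = both-≢⇒≡ bd u≢b
        -- Paths of span k+1 starting at i, i+1, u and i+k+1 determine in turn the colours of i+k+1,
        -- i+k+2, u+k+1 and i+2k+2.
        p₁ : g (i + suc k) ≢ g u
        p₁ = span-k+1 i u (i + suc k) (ℕ.≤-trans (ℕ.n≤1+n _) 2+i≤u) u≤i+k refl i≡u
        b≡ : g (suc i) ≡ g (i + suc k)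
        b≡ = both-≢⇒≡ (u≢b ∘ sym) p₁
        p₂ : g (i + (2 + k)) ≢ g (suc i)
        p₂ h = span-k+1 (suc i) (i + suc k) (i + (2 + k))
          (lia (i ∷ k ∷ []) (λ i k → # 1 :≤ k :⇒ # 1 :+ i :< i :+ (# 1 :+ k)) 1≤k)
          (lia (i ∷ k ∷ []) λ i k → i :+ (# 1 :+ k) :≤ # 1 :+ i :+ k)
          (lia (i ∷ k ∷ []) λ i k → i :+ (# 2 :+ k) :≡ # 1 :+ i :+ (# 1 :+ k))
          b≡ (trans h b≡)
        u≡ : g u ≡ g (i + (2 + k))
        u≡ = both-≢⇒≡ u≢b p₂
        p₃ : g (u + suc k) ≢ g u
        p₃ h = span-k+1 u (i + (2 + k)) (u + suc k)
          (lia (i ∷ k ∷ u ∷ []) (λ i k u → u :≤ i :+ k :⇒ u :< i :+ (# 2 :+ k)) u≤i+k)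
          (lia (i ∷ k ∷ u ∷ []) (λ i k u → # 2 :+ i :≤ u :⇒ i :+ (# 2 :+ k) :≤ u :+ k) 2+i≤u)
          refl u≡ (trans h u≡)
        b≡′ : g (i + suc k) ≡ g (u + suc k)
        b≡′ = both-≢⇒≡ p₁ p₃
        p₄ : g (i + (2 * k + 2)) ≢ g (suc i)
        p₄ h = span-k+1 (i + suc k) (u + suc k) (i + (2 * k + 2))
          (lia (i ∷ k ∷ u ∷ []) (λ i k u → # 2 :+ i :≤ u :⇒ i :+ (# 1 :+ k) :< u :+ (# 1 :+ k)) 2+i≤u)
          (lia (i ∷ k ∷ u ∷ []) (λ i k u → u :≤ i :+ k :⇒ u :+ (# 1 :+ k) :≤ i :+ (# 1 :+ k) :+ k) u≤i+k)
          (lia (i ∷ k ∷ []) λ i k → i :+ (2 :* k :+ # 2) :≡ i :+ (# 1 :+ k) :+ (# 1 :+ k))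
          b≡′ (trans h (trans b≡ b≡′))

    block : ∀ u → i < u → u ≤ i + k → g u ≡ g (suc i)
    block u i<u u≤i+k with suc i ℕ.≟ u
    ... | yes refl = refl
    ... | no  1+i≢u = decidable-stable (g u Bool.≟ g (suc i))
      (short-block-impossible u (ℕ.≤∧≢⇒< i<u 1+i≢u) u≤i+k)

    record Next : Set where
      constructor next
      field
        {end}    : ℕ
        length   : end ≡ i + k ⊎ end ≡ i + suc k
        colour   : g end ≡ g (suc i)
        boundary : Boundary end
        inside   : ∀ q → i < q → q < end → g q ≡ g (suc q)

    -- By `block`, the k positions after `i` share a colour. If i+k+1 has it too, then i+k+2 cannot,
    -- because i+1, i+k+1, i+k+2 is a path of span k+1.
    next-boundary : Next
    next-boundary with g (i + k) Bool.≟ g (suc (i + k))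
    ... | no bd′ = next (inj₁ refl) (block (i + k) i<i+k ℕ.≤-refl) bd′ inside
      where
      i<i+k : i < i + k
      i<i+k = ℕ.m<m+n i 1≤k
      inside : ∀ q → i < q → q < i + k → g q ≡ g (suc q)
      inside q i<q q<i+k = trans (block q i<q (ℕ.<⇒≤ q<i+k)) (sym (block (suc q) (ℕ.m<n⇒m<1+n i<q) q<i+k))
    ... | yes same = next (inj₂ refl) end≡ bd′ inside
      where
      last : g (suc (i + k)) ≡ g (suc i)
      last = trans (sym same) (block (i + k) (ℕ.m<m+n i 1≤k) ℕ.≤-refl)
      end≡ : g (i + suc k) ≡ g (suc i)
      end≡ = trans (cong g (ℕ.+-suc i k)) last
      bd′ : Boundary (i + suc k)
      bd′ h = span-k+1 (suc i) (i + suc k) (suc (i + suc k))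
        (lia (i ∷ k ∷ []) (λ i k → # 1 :≤ k :⇒ # 1 :+ i :< i :+ (# 1 :+ k)) 1≤k)
        (ℕ.≤-reflexive (ℕ.+-suc i k)) refl (sym end≡) (sym h)
      inside : ∀ q → i < q → q < i + suc k → g q ≡ g (suc q)
      inside q i<q q<end with ℕ.m≤n⇒m<n∨m≡n (ℕ.≤-pred (subst (q <_) (ℕ.+-suc i k) q<end))
      ... | inj₁ q<i+k = trans (block q i<q (ℕ.<⇒≤ q<i+k)) (sym (block (suc q) (ℕ.m<n⇒m<1+n i<q) q<i+k))
      ... | inj₂ refl  = same

  Chain : ℕ → ℕ → Set
  Chain p q = ∃ λ a → ∃ λ b → q ≡ p + (a * k + b * suc k) × g q ≡ alternate (a + b) (g p)

  -- An arc has no boundary in its interior, so the next boundary after `p` cannot jump over `q`.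
  -- Every arc has length at least k ≥ 1, so the distance to `q` suffices as fuel.
  chain : ∀ fuel {p q} → p ≤ q → q ≤ p + fuel → Boundary p → Boundary q → Chain p q
  chain fuel {p} {q} p≤q q≤ bp bq with p ℕ.≟ q
  ... | yes refl = 0 , 0 , sym (ℕ.+-identityʳ p) , refl
  chain zero {p} {q} p≤q q≤ bp bq | no p≢q =
    ⊥-elim (p≢q (ℕ.≤-antisym p≤q (subst (q ≤_) (ℕ.+-identityʳ p) q≤)))
  chain (suc fuel) {p} {q} p≤q q≤ bp bq | no p≢q = step (next-boundary bp)
    where
    p<q : p < q
    p<q = ℕ.≤∧≢⇒< p≤q p≢q
    step : Next bp → Chain p q
    step (next {j} len col bj inside) = extend len
      (chain fuel j≤q (lia (p ∷ q ∷ j ∷ k ∷ fuel ∷ [])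
        (λ p q j k s → # 1 :≤ k :⇒ j :≡ p :+ k :⊎ j :≡ p :+ (# 1 :+ k) :⇒ q :≤ p :+ (# 1 :+ s) :⇒ q :≤ j :+ s)
        1≤k len q≤) bj bq)
      where
      j≤q : j ≤ q
      j≤q = ℕ.≮⇒≥ (λ q<j → bq (inside q p<q q<j))
      gj : g j ≡ not (g p)
      gj = trans col (≢⇒≡not bp)
      extend : j ≡ p + k ⊎ j ≡ p + suc k → Chain j q → Chain p q
      extend (inj₁ refl) (a , b , q≡ , gq) = suc a , b ,
        lia (p ∷ q ∷ k ∷ a * k ∷ b * suc k ∷ []) (λ p q k ak bk → q :≡ p :+ k :+ (ak :+ bk) :⇒
          q :≡ p :+ (k :+ ak :+ bk)) q≡ ,
        trans gq (cong (alternate (a + b)) gj)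
      extend (inj₂ refl) (a , b , q≡ , gq) = a , suc b ,
        lia (p ∷ q ∷ k ∷ a * k ∷ b * suc k ∷ []) (λ p q k ak bk → q :≡ p :+ (# 1 :+ k) :+ (ak :+ bk) :⇒
          q :≡ p :+ (ak :+ (# 1 :+ k :+ bk))) q≡ ,
        trans gq (trans (cong (alternate (a + b)) gj) (cong (λ z → alternate z (g p)) (sym (ℕ.+-suc a b))))

  constant-or-boundary : ∀ j → (∀ i → i ≤ j → g i ≡ g 0) ⊎ ∃ Boundary
  constant-or-boundary zero = inj₁ λ { zero _ → refl }
  constant-or-boundary (suc j) with constant-or-boundary j | g j Bool.≟ g (suc j)
  ... | inj₂ bd    | _     = inj₂ bd
  ... | inj₁ _     | no bd = inj₂ (j , bd)
  ... | inj₁ const | yes e = inj₁ λ i i≤1+j → [ (λ l → const i (ℕ.≤-pred l)) ,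
    (λ { refl → trans (sym e) (const j ℕ.≤-refl) }) ]′ (ℕ.m≤n⇒m<n∨m≡n i≤1+j)

  some-boundary : ∃ Boundary
  some-boundary with constant-or-boundary (suc k)
  ... | inj₂ bd    = bd
  ... | inj₁ const = ⊥-elim (span-k+1 0 1 (suc k) (s≤s z≤n) 1≤k refl
    (sym (const 1 (s≤s z≤n))) (trans (const (suc k) ℕ.≤-refl) (sym (const 1 (s≤s z≤n)))))

  -- One lap is walked from a boundary `i` rather than from 0, which may lie inside an arc. The
  -- colour changes at each arc and returns after the lap, so the number of arcs is even; being
  -- nonzero, it is at least 2.
  even-representation : ∀ n → 1 ≤ n → (∀ x → g (x + n) ≡ g x) → HasEvenRepresentation k n
  even-representation n 1≤n periodic with some-boundary
  ... | i , bd with chain n (ℕ.m≤m+n i n) ℕ.≤-refl bd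
    (λ e → bd (trans (sym (periodic i)) (trans e (periodic (suc i)))))
  ...   | a , b , i+n≡ , col = a , b , n≡ , 2≤ , even
    where
    n≡ : n ≡ a * k + b * suc k
    n≡ = ℕ.+-cancelˡ-≡ i n _ i+n≡
    even : 2 ∣ a + b
    even = alternate-even (a + b) (g i) (trans (sym col) (periodic i))
    2≤ : 2 ≤ a + b
    2≤ with a + b in eq | even
    ... | zero  | _ = ⊥-elim (ℕ.<⇒≢ 1≤n (sym (trans n≡ (cong₂ (λ x y → x * k + y * suc k)
      (ℕ.m+n≡0⇒m≡0 a eq) (ℕ.m+n≡0⇒n≡0 a eq)))))
    ... | suc _ | e = ∣⇒≤ e

-- Colourings by arcs

periodic-multiple : ∀ {A : Set} {n} {g : ℕ → A} → (∀ x → g (x + n) ≡ g x) → ∀ x i → g (x + i * n) ≡ g x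
periodic-multiple {g = g} period x zero = cong g (ℕ.+-identityʳ x)
periodic-multiple {n = n} {g} period x (suc i) =
  trans (cong g (sym (ℕ.+-assoc x n (i * n)))) (trans (periodic-multiple period (x + n) i) (period x))

suc-%-distrib : ∀ N {{_ : NonZero N}} j → suc j % N ≡ suc (j % N) % N
suc-%-distrib N j = trans (cong (λ z → suc z % N) (m≡m%n+[m/n]*n j N)) ([m+kn]%n≡m%n (suc (j % N)) (j / N) N)

suc-% : ∀ N {{_ : NonZero N}} j →
  suc (j % N) < N × suc j % N ≡ suc (j % N) ⊎ suc (j % N) ≡ N × suc j % N ≡ 0
suc-% N j with ℕ.m≤n⇒m<n∨m≡n (m%n<n j N)
... | inj₁ l = inj₁ (l , trans (suc-%-distrib N j) (m<n⇒m%n≡m l))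
... | inj₂ e = inj₂ (e , trans (suc-%-distrib N j) (trans (cong (_% N) e) (n%n≡0 N)))

-- The palette may be larger than two, so that the alternation also serves the colouring with a
-- third colour.
parity : ∀ {c} → ℕ → Fin (2 + c)
parity zero          = zero
parity (suc zero)    = suc zero
parity (suc (suc j)) = parity j

parity-suc : ∀ {c} j → parity {c} (suc j) ≢ parity j
parity-suc zero          ()
parity-suc (suc zero)    ()
parity-suc (suc (suc j)) = parity-suc j

parity-or-suc : ∀ {c} j → parity {c} j ≡ zero ⊎ parity {c} (suc j) ≡ zero
parity-or-suc zero          = inj₁ refl
parity-or-suc (suc zero)    = inj₂ refl
parity-or-suc (suc (suc j)) = parity-or-suc j

parity-+even : ∀ {c} j i → parity {c} (j + i * 2) ≡ parity j
parity-+even zero          zero    = refl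
parity-+even {c} zero      (suc i) = parity-+even {c} zero i
parity-+even (suc zero)    zero    = refl
parity-+even {c} (suc zero) (suc i) = parity-+even {c} (suc zero) i
parity-+even (suc (suc j)) i       = parity-+even j i

-- ℕ is cut into blocks: m blocks of length k followed by b blocks of length r,
-- repeated with period m + b.
module Blocks (k r m b : ℕ) (1≤k : 1 ≤ k) (1≤r : 1 ≤ r) (r≤1+k : r ≤ suc k) {{_ : NonZero (m + b)}} where

  N n : ℕ
  N = m + b
  n = m * k + b * r

  length-at : ℕ → ℕ
  length-at i with i ℕ.<? m
  ... | yes _ = k
  ... | no  _ = r

  length : ℕ → ℕ
  length j = length-at (j % N)

  length-first : ∀ {i} → i < m → length-at i ≡ k
  length-first {i} l with i ℕ.<? m
  ... | yes _ = refl
  ... | no ¬l = ⊥-elim (¬l l)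

  length-rest : ∀ {i} → m ≤ i → length-at i ≡ r
  length-rest {i} l with i ℕ.<? m
  ... | yes l′ = ⊥-elim (ℕ.<⇒≱ l′ l)
  ... | no _   = refl

  length-property : ∀ {P : ℕ → Set} → P k → P r → ∀ j → P (length j)
  length-property p q j with j % N ℕ.<? m
  ... | yes _ = p
  ... | no  _ = q

  1≤length : ∀ j → 1 ≤ length j
  1≤length = length-property 1≤k 1≤r

  length≤1+k : ∀ j → length j ≤ suc k
  length≤1+k = length-property {_≤ suc k} (ℕ.n≤1+n k) r≤1+k

  length-period : ∀ j → length (j + N) ≡ length j
  length-period j = cong length-at ([m+n]%n≡m%n j N)

  start : ℕ → ℕ
  start zero    = 0
  start (suc j) = start j + length j

  start-long : ∀ j → j ≤ m → start j ≡ j * k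
  start-long zero    _   = refl
  start-long (suc j) j<m = trans (cong₂ _+_ (start-long j (ℕ.<⇒≤ j<m)) (length-first
    (subst (_< m) (sym (m<n⇒m%n≡m (ℕ.<-≤-trans j<m (ℕ.m≤m+n m b)))) j<m))) (ℕ.+-comm (j * k) k)

  start-rest : ∀ j → j ≤ b → start (m + j) ≡ m * k + j * r
  start-rest zero    _   = trans (cong start (ℕ.+-identityʳ m))
    (trans (start-long m ℕ.≤-refl) (sym (ℕ.+-identityʳ (m * k))))
  start-rest (suc j) j<b = trans (cong start (ℕ.+-suc m j))
    (trans (cong₂ _+_ (start-rest j (ℕ.<⇒≤ j<b)) (length-rest
      (subst (m ≤_) (sym (m<n⇒m%n≡m (ℕ.+-monoʳ-< m j<b))) (ℕ.m≤m+n m j))))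
      (trans (ℕ.+-assoc (m * k) (j * r) r) (cong (m * k +_) (ℕ.+-comm (j * r) r))))

  start-period : ∀ j → start (j + N) ≡ start j + n
  start-period zero    = start-rest b ℕ.≤-refl
  start-period (suc j) = lia (start (j + N) ∷ length (j + N) ∷ start j ∷ length j ∷ n ∷ [])
    (λ s l s′ l′ n → s :≡ s′ :+ n :⇒ l :≡ l′ :⇒ s :+ l :≡ s′ :+ l′ :+ n) (start-period j) (length-period j)

  start-mono : ∀ {i j} → i ≤ j → start i ≤ start j
  start-mono {j = zero}  z≤n = z≤n
  start-mono {i} {suc j} i≤1+j with ℕ.m≤n⇒m<n∨m≡n i≤1+j
  ... | inj₁ i<1+j = ℕ.≤-trans (start-mono (ℕ.≤-pred i<1+j)) (ℕ.m≤m+n (start j) (length j))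
  ... | inj₂ refl  = ℕ.≤-refl

  InBlock : ℕ → ℕ → Set
  InBlock x j = start j ≤ x × x < start (suc j)

  locate : ∀ x → ∃ (InBlock x)
  locate zero    = 0 , z≤n , 1≤length 0
  locate (suc x) with locate x
  ... | j , s≤x , x<e with ℕ.m≤n⇒m<n∨m≡n x<e
  ...   | inj₁ 1+x<e = j , ℕ.m≤n⇒m≤1+n s≤x , 1+x<e
  ...   | inj₂ 1+x≡e = suc j , ℕ.≤-reflexive (sym 1+x≡e) ,
    subst (_< start (2 + j)) (sym 1+x≡e) (ℕ.m<m+n (start (suc j)) (1≤length (suc j)))

  -- Applied in both directions with `x` = `y`, it shows that a position lies in only one block.
  inBlock-mono : ∀ {x y i j} → x ≤ y → InBlock x i → InBlock y j → i ≤ j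
  inBlock-mono x≤y (s≤x , _) (_ , y<e) = ℕ.≮⇒≥ λ j<i →
    ℕ.<⇒≱ (ℕ.<-≤-trans y<e (ℕ.≤-trans (start-mono j<i) s≤x)) x≤y

  block : ℕ → ℕ
  block x = proj₁ (locate x)

  block-period : ∀ x → block (x + n) ≡ block x + N
  block-period x = ℕ.≤-antisym (inBlock-mono ℕ.≤-refl (proj₂ (locate (x + n))) shifted)
    (inBlock-mono ℕ.≤-refl shifted (proj₂ (locate (x + n))))
    where
    shifted : InBlock (x + n) (block x + N)
    shifted = subst (_≤ x + n) (sym (start-period (block x))) (ℕ.+-monoˡ-≤ n (proj₁ (proj₂ (locate x)))) ,
      subst (x + n <_) (sym (start-period (suc (block x)))) (ℕ.+-monoˡ-< n (proj₂ (proj₂ (locate x))))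

  same-block-close : ∀ {x y} → block x ≡ block y → y ≤ x + k
  same-block-close {x} {y} eq with locate x | locate y
  same-block-close {x} {y} refl | j , s≤x , _ | _ , _ , y<e =
    lia (x ∷ y ∷ start j ∷ length j ∷ k ∷ [])
      (λ x y s l k → s :≤ x :⇒ y :< s :+ l :⇒ l :≤ # 1 :+ k :⇒ y :≤ x :+ k)
      s≤x y<e (length≤1+k j)

  -- The condition keeps equal colours in different blocks more than k apart. One block of length at
  -- least k in between is enough; around a shorter block the two neighbours must differ as well,
  -- and then at least two blocks lie in between.
  module _ {c} (colour : ℕ → Fin c) (colour-period : ∀ j → colour (j + N) ≡ colour j)
    (separated : ∀ j → colour (1 + j) ≢ colour j ×
      (k ≤ length (1 + j) ⊎ (colour (2 + j) ≢ colour j × k ≤ length (1 + j) + length (2 + j)))) where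

    colour-of : ℕ → Fin c
    colour-of = colour ∘ block

    colour-of-period : ∀ x → colour-of (x + n) ≡ colour-of x
    colour-of-period x = trans (cong colour (block-period x)) (colour-period (block x))

    same-colour-same-block : ∀ {x y} → x < y → y ≤ x + k → colour-of x ≡ colour-of y → block x ≡ block y
    same-colour-same-block {x} {y} x<y y≤x+k eq with locate x | locate y
    ... | j , in-j@(_ , x<e) | i , in-i@(s≤y , _) = gap (i ∸ j) (sym (ℕ.m∸n+n≡m j≤i))
      where
      j≤i : j ≤ i
      j≤i = inBlock-mono (ℕ.<⇒≤ x<y) in-j in-i
      far : ∀ {l} → k ≤ l → start (suc j) + l ≤ start i → ⊥
      far {l} k≤l s≤s′ = lia (x ∷ y ∷ k ∷ l ∷ start (suc j) ∷ start i ∷ [])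
        (λ x y k l e s → k :≤ l :⇒ e :+ l :≤ s :⇒ x :< e :⇒ s :≤ y :⇒ y :≤ x :+ k :⇒ :⊥) k≤l s≤s′ x<e s≤y y≤x+k
      -- For d ≥ 1 there are d - 1 whole blocks between `x` and `y`.
      gap : ∀ d → i ≡ d + j → j ≡ i
      gap zero                refl = refl
      gap (suc zero)          refl = ⊥-elim (proj₁ (separated j) (sym eq))
      gap (suc (suc zero))    refl with proj₂ (separated j)
      ... | inj₁ k≤l       = ⊥-elim (far k≤l ℕ.≤-refl)
      ... | inj₂ (≢ , _)   = ⊥-elim (≢ (sym eq))
      gap (suc (suc (suc d))) refl = ⊥-elim (far k≤l
        (subst (_≤ start i) (ℕ.+-assoc (start (suc j)) (length (1 + j)) (length (2 + j)))
          (start-mono (ℕ.+-monoʳ-≤ 3 (ℕ.m≤n+m j d)))))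
        where
        k≤l : k ≤ length (1 + j) + length (2 + j)
        k≤l with proj₂ (separated j)
        ... | inj₁ k≤l       = ℕ.≤-trans k≤l (ℕ.m≤m+n _ _)
        ... | inj₂ (_ , k≤l) = k≤l

module _ {k m : ℕ} (2k+2≤n : 2 * k + 2 ≤ suc m) where

  open Cycle k m

  -- In a monochromatic path both ends lie in the block of the middle vertex. They are then at most
  -- k apart, hence adjacent or equal.
  blocks⇒path-colouring : ∀ {c} {g : ℕ → Fin c} (block : ℕ → ℕ) → (∀ x → g (x + n) ≡ g x) →
    (∀ {x y} → x < y → y ≤ x + k → g x ≡ g y → block x ≡ block y) →
    (∀ {x y} → block x ≡ block y → y ≤ x + k) →
    PathColouring 2k+2≤n (g ∘ toℕ)
  blocks⇒path-colouring {g = g} block period same close {x} {u} {y} (ux , uy , xy , x≢y) gx≡gu gy≡gu =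
    impossible (neighbour ux) (neighbour uy)
    where
    t : ℕ
    t = toℕ u + n
    g-pt : ∀ a → g (toℕ (pt a)) ≡ g a
    g-pt a = trans (cong g (toℕ-pt a)) (sym (trans (cong g (m≡m%n+[m/n]*n a n))
      (periodic-multiple period (a % n) (a / n))))
    in-block : ∀ {v a} → v ≡ pt a → Close t a → g (toℕ v) ≡ g (toℕ u) → block a ≡ block t
    in-block {a = a} refl close eq with trans (trans (sym (g-pt a)) eq) (sym (period (toℕ u))) | close
    ... | ga≡gt | inj₁ (t<a , l) = sym (same t<a l (sym ga≡gt))
    ... | ga≡gt | inj₂ (a<t , l) = same a<t l ga≡gt
    impossible : (∃ λ a → x ≡ pt a × Close t a) → (∃ λ b → y ≡ pt b × Close t b) → ⊥
    impossible (a , x≡ , ta) (b , y≡ , tb) = x≢y (trans x≡ (trans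
      (cong pt (independent⇒≡ 2k+2≤n ta tb (close (sym a~b)) (close a~b) (subst₂ (λ v w → ¬ Adj k v w) x≡ y≡ xy)))
      (sym y≡)))
      where
      a~b : block a ≡ block b
      a~b = trans (in-block x≡ ta gx≡gu) (sym (in-block y≡ tb gy≡gu))

  -- The alternation survives the passage from the last block to the first because the number of
  -- blocks is even.
  two-colouring : 1 ≤ k → HasEvenRepresentation k n → ∃ λ (f : Fin n → Fin 2) → PathColouring 2k+2≤n f
  two-colouring 1≤k (a , b , n≡ , 2≤a+b , divides q a+b≡) = g ∘ toℕ ,
    blocks⇒path-colouring block
      (λ x → subst (λ z → g (x + z) ≡ g x) (sym n≡) (colour-of-period colour colour-period separated x))
      (same-colour-same-block colour colour-period separated) same-block-close
    where
    instance
      nonZero : NonZero (a + b)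
      nonZero = >-nonZero (ℕ.≤-trans (s≤s z≤n) 2≤a+b)
    open Blocks k (suc k) a b 1≤k (s≤s z≤n) ℕ.≤-refl hiding (n)
    colour : ℕ → Fin 2
    colour = parity
    colour-period : ∀ j → colour (j + (a + b)) ≡ colour j
    colour-period j = trans (cong (λ z → parity (j + z)) a+b≡) (parity-+even j q)
    separated : ∀ j → colour (1 + j) ≢ colour j ×
      (k ≤ length (1 + j) ⊎ (colour (2 + j) ≢ colour j × k ≤ length (1 + j) + length (2 + j)))
    separated j = parity-suc j , inj₁ (length-property {k ≤_} ℕ.≤-refl (ℕ.n≤1+n k) (suc j))
    g : ℕ → Fin 2
    g = colour-of colour colour-period separated

  -- Cut the cycle into M blocks of length k and a last one of length at most k. Colour the blocks
  -- alternately, except that the last block of even index has a colour of its own: then the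
  -- neighbours of the short block have different colours.
  three-colouring : 1 ≤ k → ∀ c → ∃ λ (f : Fin n → Fin (3 + c)) → PathColouring 2k+2≤n f
  three-colouring 1≤k c = g ∘ toℕ ,
    blocks⇒path-colouring block
      (λ x → subst (λ z → g (x + z) ≡ g x) (sym n≡) (colour-of-period colour colour-period separated x))
      (same-colour-same-block colour colour-period separated) same-block-close
    where
    instance
      k≢0 : NonZero k
      k≢0 = >-nonZero 1≤k
    -- Dividing n - 1 instead of n puts the last length between 1 and k, so no block is empty.
    M r : ℕ
    M = m / k
    r = suc (m % k)
    r≤k : r ≤ k
    r≤k = m%n<n m k
    2≤M : 2 ≤ M
    2≤M = ℕ.≮⇒≥ λ M<2 → lia (m ∷ k ∷ m % k ∷ M * k ∷ []) 
      (λ m k r Mk → m :≡ r :+ Mk :⇒ r :< k :⇒ Mk :≤ 1 :* k :⇒ 2 :* k :+ # 2 :≤ # 1 :+ m :⇒ :⊥) (m≡m%n+[m/n]*n m k) r≤k (ℕ.*-monoˡ-≤ k (ℕ.≤-pred M<2)) 2k+2≤n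
    n≡ : n ≡ M * k + 1 * r
    n≡ = lia (m ∷ m % k ∷ M * k ∷ [])
      (λ m r Mk → m :≡ r :+ Mk :⇒ # 1 :+ m :≡ Mk :+ 1 :* (# 1 :+ r)) (m≡m%n+[m/n]*n m k)
    instance
      M+1≢0 : NonZero (M + 1)
      M+1≢0 = >-nonZero (ℕ.m≤n+m 1 M)
    open Blocks k r M 1 1≤k (s≤s z≤n) (ℕ.m≤n⇒m≤1+n r≤k) hiding (n; N)

    -- One of the last two blocks has even index. Once it is recoloured, the other one has colour 1,
    -- so neither clashes with block 0, which keeps colour 0 because M ≥ 2.
    special : ∃ λ s → parity {1 + c} s ≡ zero × s ≢ 0 × (s ≡ M ⊎ suc s ≡ M)
    special = find M 2≤M
      where
      find : ∀ M → 2 ≤ M → ∃ λ s → parity {1 + c} s ≡ zero × s ≢ 0 × (s ≡ M ⊎ suc s ≡ M)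
      find (suc zero)    (s≤s ())
      find (suc (suc i)) _ with parity-or-suc {1 + c} (suc i)
      ... | inj₁ even = suc i , even , (λ ()) , inj₂ refl
      ... | inj₂ even = suc (suc i) , even , (λ ()) , inj₁ refl

    s : ℕ
    s = proj₁ special

    colour-at : ℕ → Fin (3 + c)
    colour-at i with i ℕ.≟ s
    ... | yes _ = suc (suc zero)
    ... | no  _ = parity i

    parity≢2 : ∀ {c} i → parity {1 + c} i ≢ suc (suc zero)
    parity≢2 zero          ()
    parity≢2 (suc zero)    ()
    parity≢2 (suc (suc i)) = parity≢2 i

    colour-at-suc : ∀ i → colour-at (suc i) ≢ colour-at i
    colour-at-suc i with suc i ℕ.≟ s | i ℕ.≟ s
    ... | yes 1+i≡s | yes i≡s = λ _ → ℕ.1+n≢n (trans 1+i≡s (sym i≡s))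
    ... | yes _     | no  _   = parity≢2 i ∘ sym
    ... | no  _     | yes _   = parity≢2 (suc i)
    ... | no  _     | no  _   = parity-suc i

    colour-at-0 : colour-at 0 ≡ zero
    colour-at-0 with 0 ℕ.≟ s
    ... | yes 0≡s = ⊥-elim (proj₁ (proj₂ (proj₂ special)) (sym 0≡s))
    ... | no  _   = refl

    colour-at-last : ∀ {i} → i ≡ M ⊎ suc i ≡ M → colour-at i ≢ zero
    colour-at-last {i} last with i ℕ.≟ s
    ... | yes _   = λ ()
    ... | no  i≢s = λ even → neighbour-of-s last (proj₂ (proj₂ (proj₂ special))) even
      where
      s-even : parity s ≡ zero
      s-even = proj₁ (proj₂ special)
      neighbour-of-s : i ≡ M ⊎ suc i ≡ M → s ≡ M ⊎ suc s ≡ M → parity i ≢ zero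
      neighbour-of-s (inj₁ i≡M) (inj₁ s≡M) = λ _ → i≢s (trans i≡M (sym s≡M))
      neighbour-of-s (inj₂ i≡M) (inj₂ s≡M) = λ _ → i≢s (ℕ.suc-injective (trans i≡M (sym s≡M)))
      neighbour-of-s (inj₁ i≡M) (inj₂ s≡M) even =
        parity-suc s (trans (cong parity (trans s≡M (sym i≡M))) (trans even (sym s-even)))
      neighbour-of-s (inj₂ i≡M) (inj₁ s≡M) even =
        parity-suc i (trans (cong parity (trans i≡M (sym s≡M))) (trans s-even (sym even)))

    colour : ℕ → Fin (3 + c)
    colour j = colour-at (j % (M + 1))
    colour-period : ∀ j → colour (j + (M + 1)) ≡ colour j
    colour-period j = cong colour-at ([m+n]%n≡m%n j (M + 1))

    next-index : ∀ j →
      suc (j % (M + 1)) ≤ M × suc j % (M + 1) ≡ suc (j % (M + 1)) ⊎ j % (M + 1) ≡ M × suc j % (M + 1) ≡ 0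
    next-index j = [ (λ (l , e) → inj₁ (ℕ.≤-pred (subst (suc (suc (j % (M + 1))) ≤_) (ℕ.+-comm M 1) l) , e)) ,
      (λ (e′ , e) → inj₂ (ℕ.suc-injective (trans e′ (ℕ.+-comm M 1)) , e)) ]′ (suc-% (M + 1) j)

    long : ∀ {j i} → j % (M + 1) ≡ i → i < M → k ≤ length j
    long refl l = ℕ.≤-reflexive (sym (length-first l))

    Separated : ℕ → Set
    Separated j = colour (1 + j) ≢ colour j ×
      (k ≤ length (1 + j) ⊎ (colour (2 + j) ≢ colour j × k ≤ length (1 + j) + length (2 + j)))

    differ : ∀ {i j p q} → i % (M + 1) ≡ p → j % (M + 1) ≡ q → colour-at p ≢ colour-at q → colour i ≢ colour j
    differ refl refl h = h

    last≢first : ∀ {i} → i ≡ M ⊎ suc i ≡ M → colour-at 0 ≢ colour-at i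
    last≢first last h = colour-at-last last (trans (sym h) colour-at-0)

    separated : ∀ j → Separated j
    separated j with next-index j
    ... | inj₂ (j%≡M , 1+j%≡0) =
      differ {1 + j} {j} 1+j%≡0 j%≡M (last≢first (inj₁ refl)) ,
      inj₁ (long {1 + j} 1+j%≡0 (ℕ.≤-trans (s≤s z≤n) 2≤M))
    ... | inj₁ (l , 1+j%≡) with ℕ.m≤n⇒m<n∨m≡n l
    ...   | inj₁ 1+j%<M = differ {1 + j} {j} 1+j%≡ refl (colour-at-suc (j % (M + 1))) ,
      inj₁ (long {1 + j} 1+j%≡ 1+j%<M)
    -- The block after `j` is the short one, and its other neighbour is block 0, of length k.
    ...   | inj₂ 1+j%≡M = differ {1 + j} {j} 1+j%≡ refl (colour-at-suc (j % (M + 1))) , inj₂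
      (differ {2 + j} {j} 2+j%≡0 refl (last≢first (inj₂ 1+j%≡M)) ,
       ℕ.≤-trans (long {2 + j} 2+j%≡0 (ℕ.≤-trans (s≤s z≤n) 2≤M)) (ℕ.m≤n+m _ _))
      where
      2+j%≡0 : (2 + j) % (M + 1) ≡ 0
      2+j%≡0 with next-index (1 + j)
      ... | inj₂ (_ , e) = e
      ... | inj₁ (l′ , _) = ⊥-elim (ℕ.<-irrefl (trans 1+j%≡ 1+j%≡M) l′)

    g : ℕ → Fin (3 + c)
    g = colour-of colour colour-period separated

-- Chromatic numbers

fin2⇒bool : Fin 2 → Bool
fin2⇒bool zero       = false
fin2⇒bool (suc zero) = true

fin2⇒bool-injective : ∀ {i j} → fin2⇒bool i ≡ fin2⇒bool j → i ≡ j
fin2⇒bool-injective {zero}     {zero}     _ = refl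
fin2⇒bool-injective {zero}     {suc zero} ()
fin2⇒bool-injective {suc zero} {zero}     ()
fin2⇒bool-injective {suc zero} {suc zero} _ = refl

fin1-unique : ∀ (i j : Fin 1) → i ≡ j
fin1-unique zero zero = refl

module _ {k m : ℕ} (1≤k : 1 ≤ k) (2k+2≤n : 2 * k + 2 ≤ suc m) where

  open Cycle k m

  private
    module _ {x u : ℕ} (x<u : x < u) (u≤x+k : u ≤ x + k) where

      left : Left u x
      left = x<u , u≤x+k

      right-k+1 : Right u (x + suc k)
      right-k+1 = lia (x ∷ u ∷ k ∷ []) (λ x u k → x :< u :⇒ u :≤ x :+ k :⇒
        u :< x :+ (# 1 :+ k) :× x :+ (# 1 :+ k) :≤ u :+ k) x<u u≤x+k

      right-k+2 : 2 + x ≤ u → Right u (x + (2 + k))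
      right-k+2 = lia (x ∷ u ∷ k ∷ []) (λ x u k → u :≤ x :+ k :⇒ # 2 :+ x :≤ u :⇒
        u :< x :+ (# 2 :+ k) :× x :+ (# 2 :+ k) :≤ u :+ k) u≤x+k

    far : ∀ x i → x + k < x + (suc i + k)
    far x i = lia (x ∷ i ∷ k ∷ []) λ x i k → x :+ k :< x :+ (# 1 :+ i :+ k)

  path-k+1 : ∀ {x u} → x < u → u ≤ x + k → Path (pt x) (pt u) (pt (x + suc k))
  path-k+1 {x} x<u u≤ = pt-path 2k+2≤n (left x<u u≤) (right-k+1 x<u u≤) (far x 0)
    (lia (x ∷ k ∷ n ∷ []) (λ x k n → 2 :* k :+ # 2 :≤ n :⇒ x :+ (# 1 :+ k) :+ k :< x :+ n) 2k+2≤n)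

  path-k+2 : 2 * k + 3 ≤ n → ∀ {x u} → 2 + x ≤ u → u ≤ x + k → Path (pt x) (pt u) (pt (x + (2 + k)))
  path-k+2 2k+3≤n {x} 2+x≤u u≤ = pt-path 2k+2≤n (left x<u u≤) (right-k+2 x<u u≤ 2+x≤u) (far x 1)
    (lia (x ∷ k ∷ n ∷ []) (λ x k n → 2 :* k :+ # 3 :≤ n :⇒ x :+ (# 2 :+ k) :+ k :< x :+ n) 2k+3≤n)
    where
    x<u = ℕ.<⇒≤ 2+x≤u

  biclique-k+1 : 3 * k + 2 ≤ n → ∀ {x u} → x < u → u ≤ x + k →
    IsBiclique k (quad (pt u) (pt u) (pt x) (pt (x + suc k)))
  biclique-k+1 3k+2≤n {x} x<u u≤ = pt-path-isBiclique 2k+2≤n (left x<u u≤) (right-k+1 x<u u≤) (far x 0)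
    (lia (x ∷ k ∷ n ∷ []) (λ x k n → 3 :* k :+ # 2 :≤ n :⇒ x :+ (# 1 :+ k) :+ k :+ k :< x :+ n) 3k+2≤n)

  biclique-k+2 : 3 * k + 3 ≤ n → ∀ {x u} → 2 + x ≤ u → u ≤ x + k →
    IsBiclique k (quad (pt u) (pt u) (pt x) (pt (x + (2 + k))))
  biclique-k+2 3k+3≤n {x} 2+x≤u u≤ = pt-path-isBiclique 2k+2≤n (left x<u u≤) (right-k+2 x<u u≤ 2+x≤u) (far x 1)
    (lia (x ∷ k ∷ n ∷ []) (λ x k n → 3 :* k :+ # 3 :≤ n :⇒ x :+ (# 2 :+ k) :+ k :+ k :< x :+ n) 3k+3≤n)
    where
    x<u = ℕ.<⇒≤ 2+x≤u

  -- The far arc from x+k+2 to x+n has length 2k, and its midpoint x+2k+2 is adjacent to both ends.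
  -- Its distance from `u` is at least k+2 in either direction.
  square-biclique : 3 * k + 2 ≡ n → ∀ {x u} → 2 + x ≤ u → u ≤ x + k →
    IsBiclique k (quad (pt u) (pt (x + (2 * k + 2))) (pt x) (pt (x + (2 + k))))
  square-biclique 3k+2≡n {x} {u} 2+x≤u u≤ = square-isBiclique 2k+2≤n
    (proj₁ xuy) (proj₁ (proj₂ xuy)) (proj₁ (proj₂ yzx)) (proj₁ yzx)
    (proj₁ (proj₂ (proj₂ uyz))) (proj₁ (proj₂ (proj₂ xuy)))
    (proj₂ (proj₂ (proj₂ uyz))) (proj₂ (proj₂ (proj₂ xuy)))
    where
    y z : ℕ
    y = x + (2 + k)
    z = x + (2 * k + 2)
    xuy : Path (pt x) (pt u) (pt y)
    xuy = path-k+2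
      (lia (k ∷ n ∷ []) (λ k n → # 1 :≤ k :⇒ 3 :* k :+ # 2 :≡ n :⇒ 2 :* k :+ # 3 :≤ n) 1≤k 3k+2≡n)
      2+x≤u u≤
    y<z : Left z y
    y<z = lia (x ∷ k ∷ []) (λ x k → # 1 :≤ k :⇒ x :+ (# 2 :+ k) :< x :+ (2 :* k :+ # 2) :×
      x :+ (2 :* k :+ # 2) :≤ x :+ (# 2 :+ k) :+ k) 1≤k
    yzx : Path (pt y) (pt z) (pt x)
    yzx = subst (Path (pt y) (pt z)) (pt-+n x) (pt-path 2k+2≤n y<z
      (lia (x ∷ k ∷ n ∷ []) (λ x k n → # 1 :≤ k :⇒ 3 :* k :+ # 2 :≡ n :⇒
        x :+ (2 :* k :+ # 2) :< x :+ n :× x :+ n :≤ x :+ (2 :* k :+ # 2) :+ k) 1≤k 3k+2≡n)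
      (lia (x ∷ k ∷ n ∷ []) (λ x k n → # 1 :≤ k :⇒ 3 :* k :+ # 2 :≡ n :⇒ x :+ (# 2 :+ k) :+ k :< x :+ n) 1≤k 3k+2≡n)
      (lia (x ∷ k ∷ n ∷ []) λ x k n → x :+ n :+ k :< x :+ (# 2 :+ k) :+ n))
    uyz : Path (pt u) (pt y) (pt z)
    uyz = pt-path 2k+2≤n (right-k+2 (ℕ.<⇒≤ 2+x≤u) u≤ 2+x≤u) y<z
      (lia (x ∷ u ∷ k ∷ []) (λ x u k → u :≤ x :+ k :⇒ u :+ k :< x :+ (2 :* k :+ # 2)) u≤)
      (lia (x ∷ u ∷ k ∷ n ∷ []) (λ x u k n → 3 :* k :+ # 2 :≡ n :⇒ # 2 :+ x :≤ u :⇒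
        x :+ (2 :* k :+ # 2) :+ k :< u :+ n) 3k+2≡n 2+x≤u)

  private
    module _ (f : Fin n → Fin 2) where

      g : ℕ → Bool
      g = fin2⇒bool ∘ f ∘ pt

      g-period : ∀ x → g (x + n) ≡ g x
      g-period x = cong (fin2⇒bool ∘ f) (pt-+n x)

  path⇒even-representation : (f : Fin n → Fin 2) → PathColouring 2k+2≤n f → HasEvenRepresentation k n
  path⇒even-representation f col with ℕ.m≤n⇒m<n∨m≡n 2k+2≤n
  -- Here positions k+2 apart are adjacent the other way round, so there is no path of span k+2; two
  -- arcs of length k+1 fill the cycle.
  ... | inj₂ 2k+2≡n = 0 , 2 ,
    lia (k ∷ n ∷ []) (λ k n → 2 :* k :+ # 2 :≡ n :⇒ n :≡ # 1 :+ k :+ (# 1 :+ k :+ # 0)) 2k+2≡n ,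
    ℕ.≤-refl , divides 1 refl
  ... | inj₁ 2k+2<n = TwoColours.even-representation k 1≤k (g f)
    (λ { x u _ x<u u≤ refl x≡u y≡u →
      col (path-k+1 x<u u≤) (fin2⇒bool-injective x≡u) (fin2⇒bool-injective y≡u) })
    (λ { x u _ _ 2+x≤u u≤ refl _ x≡u y≡u _ →
      col (path-k+2 2k+3≤n 2+x≤u u≤) (fin2⇒bool-injective x≡u) (fin2⇒bool-injective y≡u) })
    n (s≤s z≤n) (g-period f)
    where
    2k+3≤n : 2 * k + 3 ≤ n
    2k+3≤n = lia (k ∷ n ∷ []) (λ k n → 2 :* k :+ # 2 :< n :⇒ 2 :* k :+ # 3 :≤ n) 2k+2<n

  biclique⇒even-representation : 3 * k + 2 ≤ n → (f : Fin n → Fin 2) →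
    BicliqueColouring k f → HasEvenRepresentation k n
  biclique⇒even-representation 3k+2≤n f col = TwoColours.even-representation k 1≤k (g f)
    (λ { x u _ x<u u≤ refl x≡u y≡u →
      col _ (biclique-k+1 3k+2≤n x<u u≤)
        (quad-monochromatic f refl (fin2⇒bool-injective x≡u) (fin2⇒bool-injective y≡u)) })
    (λ { x u _ _ 2+x≤u u≤ refl refl x≡u y≡u z≡u →
      [ (λ 3k+2<n → col _ (biclique-k+2 (3k+3≤n 3k+2<n) 2+x≤u u≤)
          (quad-monochromatic f refl (fin2⇒bool-injective x≡u) (fin2⇒bool-injective y≡u))) ,
        (λ 3k+2≡n → col _ (square-biclique 3k+2≡n 2+x≤u u≤)
          (quad-monochromatic f (fin2⇒bool-injective z≡u) (fin2⇒bool-injective x≡u) (fin2⇒bool-injective y≡u))) ]′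
        (ℕ.m≤n⇒m<n∨m≡n 3k+2≤n) })
    n (s≤s z≤n) (g-period f)
    where
    3k+3≤n : 3 * k + 2 < n → 3 * k + 3 ≤ n
    3k+3≤n = lia (k ∷ n ∷ []) (λ k n → 3 :* k :+ # 2 :< n :⇒ 3 :* k :+ # 3 :≤ n)

  2≤colours : ∀ c (f : Fin n → Fin c) → PathColouring 2k+2≤n f → 2 ≤ c
  2≤colours zero          f col with f zero
  ... | ()
  2≤colours (suc zero)    f col =
    ⊥-elim (col (path-k+1 {0} {1} (s≤s z≤n) 1≤k) (fin1-unique _ _) (fin1-unique _ _))
  2≤colours (suc (suc c)) f col = s≤s (s≤s z≤n)

  -- Only the number of colours is transferred. One colour fails already on a path of span k+1; two
  -- colours yield arc counts, from which a colouring is rebuilt; three colours always suffice for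
  -- stars.
  biclique⇒star-colourable : 3 * k + 2 ≤ n → ∀ c →
    ∃ (λ (f : Fin n → Fin c) → BicliqueColouring k f) → ∃ λ (f : Fin n → Fin c) → StarColouring k f
  biclique⇒star-colourable 3k+2≤n zero (f , _) with f zero
  ... | ()
  biclique⇒star-colourable 3k+2≤n (suc zero) (f , col) =
    ⊥-elim (col _ (biclique-k+1 3k+2≤n {0} {1} (s≤s z≤n) 1≤k)
      (quad-monochromatic f {pt 1} {pt 1} {pt 0} {pt (suc k)} refl (fin1-unique _ _) (fin1-unique _ _)))
  biclique⇒star-colourable 3k+2≤n (suc (suc zero)) (f , col) = map₂ (path⇒star 2k+2≤n)
    (two-colouring 2k+2≤n 1≤k (biclique⇒even-representation 3k+2≤n f col))
  biclique⇒star-colourable 3k+2≤n (suc (suc (suc c))) _ =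
    map₂ (path⇒star 2k+2≤n) (three-colouring 2k+2≤n 1≤k c)

  star-chromatic-2 : HasEvenRepresentation k n → StarChromaticNumber k n 2
  star-chromatic-2 rep = map₂ (path⇒star 2k+2≤n) (two-colouring 2k+2≤n 1≤k rep) ,
    λ c f col → 2≤colours c f (star⇒path 2k+2≤n col)

  star-chromatic-3 : ¬ HasEvenRepresentation k n → StarChromaticNumber k n 3
  star-chromatic-3 ¬rep = map₂ (path⇒star 2k+2≤n) (three-colouring 2k+2≤n 1≤k 0) ,
    λ c f col → bound c f (star⇒path 2k+2≤n col)
    where
    bound : ∀ c (f : Fin n → Fin c) → PathColouring 2k+2≤n f → 3 ≤ c
    bound c f col with ℕ.m≤n⇒m<n∨m≡n (2≤colours c f col)
    ... | inj₁ 2<c  = 2<c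
    ... | inj₂ refl = ⊥-elim (¬rep (path⇒even-representation f col))

-- Comparison of chromatic numbers, and the complete case

chromatic-number-mono : ∀ {n} (P Q : ∀ {c} → (Fin n → Fin c) → Set) →
  (∀ c → ∃ (λ (f : Fin n → Fin c) → P f) → ∃ (λ (f : Fin n → Fin c) → Q f)) →
  (∀ c → ∃ (λ (f : Fin n → Fin c) → Q f) → ∃ (λ (f : Fin n → Fin c) → P f)) →
  ∀ c → IsChromaticNumber n P c → IsChromaticNumber n Q c
chromatic-number-mono P Q to from c (colouring , minimal) =
  to c colouring , λ c' f q → minimal c' (proj₁ (from c' (f , q))) (proj₂ (from c' (f , q)))

complete : ∀ {k n} → n ≤ 2 * k + 1 → ∀ {i j : Fin n} → i ≢ j → Adj k i j
complete {k} {suc m} n≤2k+1 {i} {j} i≢j = adj (reach (toℕ i) j)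
  where
  open Cycle k m
  a : ℕ
  a = toℕ i
  adj : (∃ λ e → e < n × j ≡ pt (a + e)) → Adj k i j
  adj (zero , _ , refl) = ⊥-elim (i≢j (sym (trans (cong pt (ℕ.+-identityʳ a)) (pt-toℕ i))))
  adj (e@(suc _) , e<n , refl) = subst (λ v → Adj k v (pt (a + e))) (pt-toℕ i)
    (Ahead⇒Adj (ℕ.m<m+n a (s≤s z≤n)) (ℕ.+-monoʳ-< a e<n) (ℕ.m<m+n a (s≤s z≤n) ,
      lia (a ∷ e ∷ k ∷ n ∷ []) (λ a e k n → n :≤ 2 :* k :+ # 1 :⇒ a :+ e :≤ a :+ k :⊎ a :+ n :≤ a :+ e :+ k) n≤2k+1))

module _ {k n : ℕ} (n≤2k+1 : n ≤ 2 * k + 1) where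

  -- In a complete graph any vertex of the set is universal, so the two notions, and with them their
  -- maximal sets, coincide.
  complete-bipartite⇒star : ∀ {S : Subset n} → InducesCompleteBipartite k S → InducesStar k S
  complete-bipartite⇒star bip@(_ , _ , _ , A⊆S , _ , _ , (a , a∈A) , _) =
    bip , a , A⊆S a a∈A , λ v _ v≢a → complete n≤2k+1 (v≢a ∘ sym)

  complete-star-colouring : ∀ {c} {f : Fin n → Fin c} → BicliqueColouring k f → StarColouring k f
  complete-star-colouring col S (star , maximal) =
    col S (proj₁ star , λ T S⊆T bip → maximal T S⊆T (complete-bipartite⇒star bip))

  complete-biclique-colouring : ∀ {c} {f : Fin n → Fin c} → StarColouring k f → BicliqueColouring k f
  complete-biclique-colouring col S (bip , maximal) =
    col S (complete-bipartite⇒star bip , λ T S⊆T star → maximal T S⊆T (proj₁ star))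

theorem10 : (k n : ℕ) → 1 ≤ k →
    ((n ≤ 2 * k + 1 ⊎ 3 * k + 2 ≤ n) →
    ∀ (c : ℕ) → StarChromaticNumber k n c ⇔ BicliqueChromaticNumber k n c) ×
    (2 * k + 2 ≤ n → n ≤ 3 * k + 1 →
    (HasEvenRepresentation k n → StarChromaticNumber k n 2) ×
    (¬ HasEvenRepresentation k n → StarChromaticNumber k n 3))
theorem10 k n 1≤k = equal n , λ 2k+2≤n _ → middle n 2k+2≤n
  where
  equivalent : ∀ n →
    (∀ c → ∃ (λ (f : Fin n → Fin c) → StarColouring k f) → ∃ (λ (f : Fin n → Fin c) → BicliqueColouring k f)) →
    (∀ c → ∃ (λ (f : Fin n → Fin c) → BicliqueColouring k f) → ∃ (λ (f : Fin n → Fin c) → StarColouring k f)) →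
    ∀ c → StarChromaticNumber k n c ⇔ BicliqueChromaticNumber k n c
  equivalent n to from c = mk⇔
    (chromatic-number-mono (StarColouring k) (BicliqueColouring k) to from c)
    (chromatic-number-mono (BicliqueColouring k) (StarColouring k) from to c)

  equal : ∀ n → (n ≤ 2 * k + 1 ⊎ 3 * k + 2 ≤ n) →
    ∀ c → StarChromaticNumber k n c ⇔ BicliqueChromaticNumber k n c
  equal n (inj₁ n≤2k+1) = equivalent n
    (λ c (f , col) → f , complete-biclique-colouring n≤2k+1 col)
    (λ c (f , col) → f , complete-star-colouring n≤2k+1 col)
  equal zero (inj₂ 3k+2≤0) = ⊥-elim (lia (k ∷ []) (λ k → 3 :* k :+ # 2 :≤ # 0 :⇒ :⊥) 3k+2≤0)
  equal n@(suc m) (inj₂ 3k+2≤n) = equivalent n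
    (λ c (f , col) → f , Cycle.path⇒biclique k m 2k+2≤n (Cycle.star⇒path k m 2k+2≤n col))
    (biclique⇒star-colourable 1≤k 2k+2≤n 3k+2≤n)
    where
    2k+2≤n : 2 * k + 2 ≤ n
    2k+2≤n = lia (k ∷ n ∷ []) (λ k n → 3 :* k :+ # 2 :≤ n :⇒ 2 :* k :+ # 2 :≤ n) 3k+2≤n

  middle : ∀ n → 2 * k + 2 ≤ n →
    (HasEvenRepresentation k n → StarChromaticNumber k n 2) ×
    (¬ HasEvenRepresentation k n → StarChromaticNumber k n 3)
  middle zero    2k+2≤0 = ⊥-elim (lia (k ∷ []) (λ k → 2 :* k :+ # 2 :≤ # 0 :⇒ :⊥) 2k+2≤0)
  middle (suc m) 2k+2≤n = star-chromatic-2 1≤k 2k+2≤n , star-chromatic-3 1≤k 2k+2≤n
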